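{- For every constant $k$, there exists an algorithm which, given a finite argumentation framework $F=\langle\mathcal{A},\mathcal{R}\rangle$ whose in-degree is bounded by $k$ (that is, $|y^-|\le k$ for every $y\in\mathcal{A}$), decides in time polynomial in the size of $F$ whether $F$ is naive-bijective.
   Context: All objects are finite. An argumentation framework is a pair $F=\langle \mathcal{A},\mathcal{R}\rangle$ where $\mathcal{A}$ is a finite set (of arguments) and $\mathcal{R}\subseteq\mathcal{A}\times\mathcal{A}$ (attacks; self-attacks are allowed). Its size is the size of the directed graph $(\mathcal{A},\mathcal{R})$. For $S\subseteq\mathcal{A}$: $S^+=\{x\in\mathcal{A}\mid \exists y\in S,\ (y,x)\in\mathcal{R}\}$ and $S^-=\{x\in\mathcal{A}\mid \exists y\in S,\ (x,y)\in\mathcal{R}\}$; for $y\in\mathcal{A}$, $y^-=\{y\}^-$. A set $S\subseteq\mathcal{A}$ is conflict-free if $S\cap S^+=\emptyset$; naive sets are the inclusion-wise maximal conflict-free sets, forming the family $\mathrm{NAIV}(F)$. $S$ is admissible if it is conflict-free and self-defending, i.e. $S^-\subseteq S^+$. Preferred extensions are the inclusion-wise maximal admissible sets, forming the family $\mathrm{PREF}(F)$. $F$ is naive-bijective if $\mathrm{NAIV}(F)=\mathrm{PREF}(F)$. -}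

module Defs where

open import Data.Bool using (Bool; true; false)
open import Data.Fin using (Fin)
open import Data.Fin.Properties using (any?)
open import Data.Fin.Subset using (Subset; _∈_; _⊆_; _∩_; ⁅_⁆; ∣_∣; Empty)
open import Data.Fin.Subset.Properties using (_∈?_)
open import Data.List using (List; []; _∷_; _++_)
import Data.List as List
open import Data.Nat using (ℕ; zero; suc; _+_; _*_; _^_; _≤_)
open import Data.Product using (_×_; _,_; ∃-syntax; proj₁; proj₂)
open import Data.Vec using (Vec; _∷_; lookup; tabulate; concat; toList)
import Data.Vec as Vec
open import Function.Bundles using (_↔_)
open import Level using (0ℓ)
open import Relation.Binary.PropositionalEquality using (_≡_)
open import Relation.Nullary using (Dec; does; _×-dec_; Reflects)
open import Relation.Unary using (Pred; Decidable; _≐_)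

------------------------------------------------------------------------
-- Argumentation frameworks

comprehension : ∀ {n} {P : Pred (Fin n) 0ℓ} → Decidable P → Subset n
comprehension P? = tabulate (λ x → does (P? x))

Maximal : ∀ {n} → Pred (Subset n) 0ℓ → Pred (Subset n) 0ℓ
Maximal P S = P S × (∀ T → P T → S ⊆ T → S ≡ T)

-- The set of arguments is Fin args. Row x of the matrix is the set of
-- arguments attacked by x.

record AF : Set where
  field
    args   : ℕ
    matrix : Vec (Subset args) args

  Attacks : Fin args → Fin args → Set
  Attacks x y = y ∈ lookup matrix x

  attacks? : ∀ x y → Dec (Attacks x y)
  attacks? x y = y ∈? lookup matrix x

  -- The number of vertices plus the number of edges of the digraph.
  size : ℕ
  size = args + Vec.sum (Vec.map ∣_∣ matrix)

  infix 8 _⁺ _⁻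

  _⁺ : Subset args → Subset args
  S ⁺ = comprehension (λ x → any? (λ y → (y ∈? S) ×-dec attacks? y x))

  _⁻ : Subset args → Subset args
  S ⁻ = comprehension (λ x → any? (λ y → (y ∈? S) ×-dec attacks? x y))

  ConflictFree : Pred (Subset args) 0ℓ
  ConflictFree S = Empty (S ∩ S ⁺)

  Admissible : Pred (Subset args) 0ℓ
  Admissible S = ConflictFree S × S ⁻ ⊆ S ⁺

  NAIV : Pred (Subset args) 0ℓ
  NAIV = Maximal ConflictFree

  PREF : Pred (Subset args) 0ℓ
  PREF = Maximal Admissible

  NaiveBijective : Set
  NaiveBijective = NAIV ≐ PREF

  InDegreeBoundedBy : ℕ → Set
  InDegreeBoundedBy k = ∀ y → ∣ ⁅ y ⁆ ⁻ ∣ ≤ k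

open AF public using (size; NaiveBijective; InDegreeBoundedBy)

-- The number of arguments in unary, a separator, then the adjacency
-- matrix row by row. Its length is at most quadratic in the size.

encode : AF → List Bool
encode F = List.replicate args true ++ false ∷ toList (concat matrix)
  where open AF F

------------------------------------------------------------------------
-- Deterministic multi-tape Turing machines

data Symbol (m : ℕ) : Set where
  blank : Symbol m
  bit   : Bool → Symbol m
  aux   : Fin m → Symbol m

-- A two-way infinite tape; `left` is listed from the head outwards, and
-- all cells beyond the two lists are blank.

record Tape (m : ℕ) : Set where
  constructor tape
  field
    left  : List (Symbol m)
    head  : Symbol m
    right : List (Symbol m)

data Move : Set where
  goLeft stay goRight : Move

module _ {m : ℕ} where

  uncons : List (Symbol m) → Symbol m × List (Symbol m)
  uncons []       = blank , []
  uncons (s ∷ ss) = s , ss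

  emptyTape : Tape m
  emptyTape = tape [] blank []

  -- The head starts on the first symbol of the word.
  wordTape : List Bool → Tape m
  wordTape w = tape [] (proj₁ r) (proj₂ r)
    where r = uncons (List.map bit w)

  write : Symbol m → Tape m → Tape m
  write s (tape l _ r) = tape l s r

  move : Move → Tape m → Tape m
  move goLeft  (tape l s r) = tape (proj₂ (uncons l)) (proj₁ (uncons l)) (s ∷ r)
  move stay    t            = t
  move goRight (tape l s r) = tape (s ∷ l) (proj₁ (uncons r)) (proj₂ (uncons r))

  act : Symbol m × Move → Tape m → Tape m
  act (s , d) t = move d (write s t)

-- A machine either continues in a state or halts, accepting (true) or
-- rejecting (false).

data Control (Q : Set) : Set where
  continue : Q → Control Q
  halt     : Bool → Control Q

record TuringMachine : Set₁ where
  field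
    State       : Set
    stateCount  : ℕ
    stateFinite : State ↔ Fin stateCount
    start       : State
    auxSymbols  : ℕ
    workTapes   : ℕ

  tapes : ℕ
  tapes = suc workTapes

  field
    δ : State → Vec (Symbol auxSymbols) tapes →
        Control State × Vec (Symbol auxSymbols × Move) tapes

  Config : Set
  Config = Control State × Vec (Tape auxSymbols) tapes

  initial : List Bool → Config
  initial w = continue start , wordTape w ∷ Vec.replicate workTapes emptyTape

  step : State → Vec (Tape auxSymbols) tapes → Config
  step q ts = proj₁ next , Vec.zipWith act (proj₂ next) ts
    where next = δ q (Vec.map Tape.head ts)

  -- c ⇓[ t ] b : from c the machine halts after exactly t steps with
  -- verdict b.
  data _⇓[_]_ : Config → ℕ → Bool → Set where
    halted : ∀ {b ts} → (halt b , ts) ⇓[ zero ] b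
    stepped : ∀ {q ts t b} → step q ts ⇓[ t ] b →
              (continue q , ts) ⇓[ suc t ] b

------------------------------------------------------------------------
-- Polynomial-time decision of a promise problem on frameworks

HaltsOnWithin : TuringMachine → AF → ℕ → Bool → Set
HaltsOnWithin M F bound b =
  ∃[ t ] t ≤ bound × initial (encode F) ⇓[ t ] b
  where open TuringMachine M

-- M need only behave correctly, and run in polynomial time, on the
-- frameworks satisfying Promise.

DecidesInPolynomialTime : TuringMachine → Pred AF 0ℓ → Pred AF 0ℓ → Set
DecidesInPolynomialTime M Promise Property =
  ∃[ c ] ∃[ d ] (∀ F → Promise F →
    ∃[ b ] HaltsOnWithin M F (c * size F ^ d + c) b × Reflects (Property F) b)

{-# OPTIONS --safe #-}
-- Since every conflict-free set extends to a naive one, NAIV = PREF holds iff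
-- every naive set defends itself. If a naive set S fails to defend t₀
-- against x, then S is disjoint from x⁻, so each of the at most k members of
-- x⁻ attacks itself or is in conflict with some member of S; together with t₀,
-- at most k + 1 members of S witness the failure. Conversely, a conflict-free
-- set of witnesses extends to a naive set that does not defend itself. Hence
-- bijectivity fails iff ∃ x t₀ … t_k ∀ z ψ for a quantifier-free ψ about the
-- attack relation, and a Turing machine evaluates this sentence by brute force
-- with one loop per quantifier.
module Submission where

open import Defs
open import Data.Bool using (Bool; true; false; not; _∨_; if_then_else_; T; T?)
open import Data.Bool.Properties using (∨-assoc; ∨-identityʳ; if-float; T-∨)
open import Data.Empty using (⊥; ⊥-elim)
open import Data.Fin using (Fin; zero; suc; toℕ; fromℕ<; splitAt; _↑ˡ_; _↑ʳ_; combine; remQuot)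
open import Data.Fin.Properties as Fin
  using (any?; all?; +↔⊎; 1↔⊤; splitAt-↑ˡ; splitAt-↑ʳ; remQuot-combine; toℕ-fromℕ<; toℕ<n; toℕ-combine)
open import Data.Fin.Subset using (Subset; inside; outside; _∈_; _∉_; _⊆_; ⁅_⁆; ∣_∣; _∪_)
open import Data.Fin.Subset.Properties
  using (_∈?_; ⊆-antisym; x∈p∩q⁺; x∈p∩q⁻; x∈⁅x⁆; x∈⁅y⁆⇒x≡y; x∈p∪q⁺; x∈p∪q⁻; ∣p∣≤n; p⊂q⇒∣p∣<∣q∣)
open import Data.List using (List; []; _∷_; _++_)
import Data.List as List
open import Data.List.Membership.Propositional using () renaming (_∈_ to _∈ˡ_)
open import Data.List.Membership.Propositional.Properties using (∈-allFin)
open import Data.List.Relation.Unary.All as All using (All; []; _∷_)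
open import Data.List.Relation.Unary.AllPairs using ([]; _∷_)
open import Data.List.Relation.Unary.Any using (here; there)
open import Data.List.Relation.Unary.Unique.Propositional using (Unique)
open import Data.List.Relation.Unary.Unique.Propositional.Properties using (allFin⁺)
open import Data.Nat using (ℕ; zero; suc; _+_; _*_; _^_; _≤_; _<_; z≤n; s≤s; _<?_)
import Data.Nat.Properties as ℕ
open import Data.Product using (Σ-syntax; ∃-syntax; _×_; _,_; proj₁; proj₂; uncurry)
open import Data.Sum using (_⊎_; inj₁; inj₂; [_,_]′)
open import Data.Sum.Function.Propositional using (_⊎-↔_)
open import Data.Unit using (⊤; tt)
open import Data.Vec using (Vec; []; _∷_; here; there; lookup; tabulate; replicate; _[_]≔_)
import Data.Vec as Vec
import Data.Vec.Properties as Vec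
open import Function using (_∘_; id; _↔_)
open import Function.Bundles using (module Equivalence)
open import Function.Construct.Composition using (_↔-∘_)
open import Function.Construct.Symmetry using (↔-sym)
open import Level using (0ℓ)
open import Relation.Binary.PropositionalEquality
  using (_≡_; _≢_; refl; sym; trans; cong; cong₂; subst; subst₂; module ≡-Reasoning)
open import Relation.Nullary
  using (Dec; yes; no; does; ¬_; ¬?; contradiction; _×-dec_; _⊎-dec_; _→-dec_; Reflects; ofʸ; ofⁿ)
open import Relation.Nullary.Decidable using (dec-true; dec-false; isYes; toWitness; fromWitness)
open import Relation.Unary using (Pred; Decidable)

-- The variable `z` ranges over all arguments, with an attack on `x` as a premise inside ψ, so the
-- machine never has to list the attackers of `x`. The degree bound enters through the number of
-- witnesses, which fixes the number of loops and of tapes. The obstacle on the machine side is that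
-- tapes have no random access. A separate copy of the adjacency matrix is therefore kept for every
-- ordered pair of variables, with its head on the entry indexed by their two values, and ψ is
-- decided from the scanned symbols in a single transition. The price is paid when a variable
-- changes by one: heads for which it is the column index move one cell, heads for which it is the
-- row index move a whole row. Finitely many states cannot count to the length of a row, so that
-- move is driven by a pass over a unary tape. With the `k + 3` variables `z`, `x`, `t₀`, ..., `t_k`
-- there are `(k + 3) * (k + 3)` copies, a constant for fixed `k`.

∈-comprehension⁺ : ∀ {n} {P : Pred (Fin n) 0ℓ} (P? : Decidable P) {x} → P x → x ∈ comprehension P?
∈-comprehension⁺ P? {x} px = Vec.lookup⇒[]= x _ (trans (Vec.lookup∘tabulate (does ∘ P?) x) true-at)
  where
  true-at : does (P? x) ≡ true
  true-at with P? x
  ... | yes _ = refl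
  ... | no ¬p = contradiction px ¬p

∈-comprehension⁻ : ∀ {n} {P : Pred (Fin n) 0ℓ} (P? : Decidable P) {x} → x ∈ comprehension P? → P x
∈-comprehension⁻ {P = P} P? {x} x∈ = true⇒ (trans (sym (Vec.lookup∘tabulate (does ∘ P?) x)) (Vec.[]=⇒lookup x∈))
  where
  true⇒ : does (P? x) ≡ true → P x
  true⇒ eq with P? x | eq
  ... | yes p | _ = p
  ... | no _ | ()

-- Listing the subset with exactly `k` indices makes the number of witnesses depend on the bound
-- alone; surplus indices are padded with the default.
enumerate : ∀ {n k} (p : Subset n) → ∣ p ∣ ≤ k → Fin n →
            Σ[ e ∈ (Fin k → Fin n) ] ∀ {x} → x ∈ p → ∃[ i ] e i ≡ x
enumerate {n} p ∣p∣≤k default =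
  let e , covers = go p ∣p∣≤k in
  fill ∘ e , λ x∈p → let i , eq = covers x∈p in i , cong fill eq
  where
  fill : Fin n ⊎ Fin n → Fin n
  fill = [ id , (λ _ → default) ]′
  -- The recursion can reach the empty `Fin m`, where no default exists, so padding is kept apart in
  -- the original `Fin n` until `fill` merges the two.
  go : ∀ {m k} (q : Subset m) → ∣ q ∣ ≤ k →
       Σ[ e ∈ (Fin k → Fin m ⊎ Fin n) ] ∀ {x} → x ∈ q → ∃[ i ] e i ≡ inj₁ x
  go [] _ = (λ _ → inj₂ default) , λ ()
  go (outside ∷ q) q≤k with go q q≤k
  ... | e , covers = ([ inj₁ ∘ suc , inj₂ ]′ ∘ e) ,
    λ { (there x∈q) → let i , eq = covers x∈q in i , cong [ inj₁ ∘ suc , inj₂ ]′ eq }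
  go (inside ∷ q) (s≤s q≤k) with go q q≤k
  ... | e , covers = (λ { zero → inj₁ zero ; (suc i) → [ inj₁ ∘ suc , inj₂ ]′ (e i) }) ,
    λ { here → zero , refl
      ; (there x∈q) → let i , eq = covers x∈q in suc i , cong [ inj₁ ∘ suc , inj₂ ]′ eq }

-- The failure condition described above, at one value of z: t zero is the
-- member of the naive set that x attacks, and the other t i rule out attackers
-- of x.
Refutes : ∀ {V : Set} {ℓ} → (V → V → Bool) → V → (Fin (suc ℓ) → V) → V → Set
Refutes adj x t z =
  T (adj x (t zero)) × (∀ i j → ¬ T (adj (t i) (t j))) ×
  (T (adj z x) → T (adj z z) ⊎ ∃[ i ] (T (adj z (t i)) ⊎ T (adj (t i) z)))

refutes? : ∀ {V : Set} {ℓ} (adj : V → V → Bool) x (t : Fin (suc ℓ) → V) z → Dec (Refutes adj x t z)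
refutes? adj x t z =
  T? _ ×-dec all? (λ i → all? (λ j → ¬? (T? _))) ×-dec
  (T? _ →-dec (T? _ ⊎-dec any? (λ i → T? _ ⊎-dec T? _)))

-- Naive extensions and refutations of bijectivity

module _ (F : AF) where
  open AF F hiding (size; NaiveBijective; InDegreeBoundedBy)

  adjacent : Fin args → Fin args → Bool
  adjacent x y = lookup (lookup matrix x) y

  adjacent⇒attacks : ∀ {x y} → T (adjacent x y) → Attacks x y
  adjacent⇒attacks {x} {y} a = Vec.lookup⇒[]= y _ (T⇒≡ a)
    where
    T⇒≡ : ∀ {b} → T b → b ≡ true
    T⇒≡ {true} _ = refl

  attacks⇒adjacent : ∀ {x y} → Attacks x y → T (adjacent x y)
  attacks⇒adjacent a rewrite Vec.[]=⇒lookup a = _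

  Independent : Subset args → Set
  Independent S = ∀ {x y} → x ∈ S → y ∈ S → ¬ Attacks x y

  ∈⁺ : ∀ {S x y} → y ∈ S → Attacks y x → x ∈ S ⁺
  ∈⁺ y∈S y→x = ∈-comprehension⁺ (λ x → any? (λ y → (y ∈? _) ×-dec attacks? y x)) (_ , y∈S , y→x)

  ∈⁺⇒ : ∀ S {x} → x ∈ S ⁺ → ∃[ y ] y ∈ S × Attacks y x
  ∈⁺⇒ S = ∈-comprehension⁻ (λ x → any? (λ y → (y ∈? S) ×-dec attacks? y x))

  ∈⁻ : ∀ {S x y} → y ∈ S → Attacks x y → x ∈ S ⁻
  ∈⁻ y∈S x→y = ∈-comprehension⁺ (λ x → any? (λ y → (y ∈? _) ×-dec attacks? x y)) (_ , y∈S , x→y)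

  ∈⁻⇒ : ∀ S {x} → x ∈ S ⁻ → ∃[ y ] y ∈ S × Attacks x y
  ∈⁻⇒ S = ∈-comprehension⁻ (λ x → any? (λ y → (y ∈? S) ×-dec attacks? x y))

  conflictFree⇒independent : ∀ {S} → ConflictFree S → Independent S
  conflictFree⇒independent cf x∈S y∈S x→y = cf (_ , x∈p∩q⁺ (y∈S , ∈⁺ x∈S x→y))

  independent⇒conflictFree : ∀ {S} → Independent S → ConflictFree S
  independent⇒conflictFree {S} ind (x , x∈) =
    let x∈S , x∈S⁺ = x∈p∩q⁻ S (S ⁺) x∈ ; y , y∈S , y→x = ∈⁺⇒ S x∈S⁺ in ind y∈S x∈S y→x

  Conflicts : Fin args → Fin args → Set
  Conflicts z s = Attacks z s ⊎ Attacks s z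

  -- These are exactly the obstructions to adding `z` to an independent set. Being decidable, they
  -- turn the maximality of a naive set into positive information.
  Blocked : Subset args → Fin args → Set
  Blocked S z = Attacks z z ⊎ ∃[ s ] s ∈ S × Conflicts z s

  blocked? : ∀ S → Decidable (Blocked S)
  blocked? S z = attacks? z z ⊎-dec any? (λ s → (s ∈? S) ×-dec (attacks? z s ⊎-dec attacks? s z))

  independent⇒unblocked : ∀ {S z} → Independent S → z ∈ S → ¬ Blocked S z
  independent⇒unblocked ind z∈S (inj₁ z→z) = ind z∈S z∈S z→z
  independent⇒unblocked ind z∈S (inj₂ (_ , s∈S , inj₁ z→s)) = ind z∈S s∈S z→s
  independent⇒unblocked ind z∈S (inj₂ (_ , s∈S , inj₂ s→z)) = ind s∈S z∈S s→z

  insert-independent : ∀ {S z} → Independent S → ¬ Blocked S z → Independent (⁅ z ⁆ ∪ S)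
  insert-independent {S} {z} ind free x∈ y∈ x→y with x∈p∪q⁻ ⁅ z ⁆ S x∈ | x∈p∪q⁻ ⁅ z ⁆ S y∈
  ... | inj₂ x∈S | inj₂ y∈S = ind x∈S y∈S x→y
  ... | inj₁ x∈z | inj₂ y∈S with refl ← x∈⁅y⁆⇒x≡y z x∈z = free (inj₂ (_ , y∈S , inj₁ x→y))
  ... | inj₂ x∈S | inj₁ y∈z with refl ← x∈⁅y⁆⇒x≡y z y∈z = free (inj₂ (_ , x∈S , inj₂ x→y))
  ... | inj₁ x∈z | inj₁ y∈z with refl ← x∈⁅y⁆⇒x≡y z x∈z | refl ← x∈⁅y⁆⇒x≡y z y∈z = free (inj₁ x→y)

  naive⇒blocked : ∀ {S} → NAIV S → ∀ {z} → z ∉ S → Blocked S z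
  naive⇒blocked {S} (cf , max) {z} z∉S with blocked? S z
  ... | yes b = b
  ... | no free = contradiction z∈S z∉S
    where
    S≡ : S ≡ ⁅ z ⁆ ∪ S
    S≡ = max _ (independent⇒conflictFree (insert-independent (conflictFree⇒independent cf) free))
             (x∈p∪q⁺ ∘ inj₂)
    z∈S : z ∈ S
    z∈S = subst (z ∈_) (sym S≡) (x∈p∪q⁺ (inj₁ (x∈⁅x⁆ z)))

  -- Unblocked arguments are added greedily. The fuel dominates the number of arguments still
  -- outside `S`, so it cannot run out while one can be added.
  extend-to-naive : ∀ fuel S → args ≤ fuel + ∣ S ∣ → Independent S → ∃[ N ] NAIV N × S ⊆ N
  extend-to-naive fuel S enough ind with any? (λ z → ¬? (z ∈? S) ×-dec ¬? (blocked? S z))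
  ... | no saturated = S , (independent⇒conflictFree ind , maximal) , id
    where
    maximal : ∀ U → ConflictFree U → S ⊆ U → S ≡ U
    maximal U cf S⊆U = ⊆-antisym S⊆U U⊆S
      where
      U⊆S : U ⊆ S
      -- A member of the independent `U` is not blocked by `U`, hence not by the smaller `S`;
      -- outside `S` it would contradict saturation.
      U⊆S {u} u∈U with u ∈? S
      ... | yes u∈S = u∈S
      ... | no u∉S = contradiction
        (u , u∉S , λ b → independent⇒unblocked (conflictFree⇒independent cf) u∈U (mono b)) saturated
        where
        mono : Blocked S u → Blocked U u
        mono (inj₁ u→u) = inj₁ u→u
        mono (inj₂ (s , s∈S , c)) = inj₂ (s , S⊆U s∈S , c)
  extend-to-naive fuel S enough ind | yes (z , z∉S , free) = continue-with fuel enough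
    where
    bigger : ∣ S ∣ < ∣ ⁅ z ⁆ ∪ S ∣
    bigger = p⊂q⇒∣p∣<∣q∣ ((x∈p∪q⁺ ∘ inj₂) , z , x∈p∪q⁺ (inj₁ (x∈⁅x⁆ z)) , z∉S)
    continue-with : ∀ fuel → args ≤ fuel + ∣ S ∣ → ∃[ N ] NAIV N × S ⊆ N
    continue-with zero args≤ = contradiction (ℕ.≤-trans bigger (∣p∣≤n (⁅ z ⁆ ∪ S))) (ℕ.≤⇒≯ args≤)
    continue-with (suc fuel) args≤ =
      let N , naive , ⊆N = extend-to-naive fuel (⁅ z ⁆ ∪ S)
            (ℕ.≤-trans args≤ (ℕ.≤-trans (ℕ.≤-reflexive (sym (ℕ.+-suc fuel ∣ S ∣))) (ℕ.+-monoʳ-≤ fuel bigger)))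
            (insert-independent ind free)
      in N , naive , ⊆N ∘ x∈p∪q⁺ ∘ inj₂

  independent⊆naive : ∀ {S} → Independent S → ∃[ N ] NAIV N × S ⊆ N
  independent⊆naive = extend-to-naive args _ (ℕ.m≤m+n args _)

  -- A naive extension `N` of the witnesses would be admissible, so some `z` in `N` would attack
  -- `x`. The last clause of the refutation at this `z` makes it blocked by `N`, which is impossible
  -- for a member.
  refutation⇒¬bijective : ∀ {ℓ} x (t : Fin (suc ℓ) → Fin args) →
                          (∀ z → Refutes adjacent x t z) → ¬ NaiveBijective F
  refutation⇒¬bijective x t refutes (naive⇒pref , _) = undefended
    where
    t? = λ s → any? (λ i → t i Fin.≟ s)
    independent : Independent (comprehension t?)
    independent x∈ y∈ x→y with ∈-comprehension⁻ t? x∈ | ∈-comprehension⁻ t? y∈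
    ... | i , refl | j , refl = proj₁ (proj₂ (refutes x)) i j (attacks⇒adjacent x→y)
    extension = independent⊆naive independent
    N = proj₁ extension
    naive = proj₁ (proj₂ extension)
    t∈N : ∀ i → t i ∈ N
    t∈N i = proj₂ (proj₂ extension) (∈-comprehension⁺ t? (i , refl))
    x∈N⁺ : x ∈ N ⁺
    x∈N⁺ = proj₂ (proj₁ (naive⇒pref naive)) (∈⁻ (t∈N zero) (adjacent⇒attacks (proj₁ (refutes x))))
    undefended : ⊥
    undefended with ∈⁺⇒ N x∈N⁺
    ... | z , z∈N , z→x = independent⇒unblocked (conflictFree⇒independent (proj₁ naive)) z∈N
                            (blocked (proj₂ (proj₂ (refutes z)) (attacks⇒adjacent z→x)))
      where
      blocked : T (adjacent z z) ⊎ ∃[ i ] (T (adjacent z (t i)) ⊎ T (adjacent (t i) z)) → Blocked N z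
      blocked (inj₁ a) = inj₁ (adjacent⇒attacks a)
      blocked (inj₂ (i , inj₁ a)) = inj₂ (t i , t∈N i , inj₁ (adjacent⇒attacks a))
      blocked (inj₂ (i , inj₂ a)) = inj₂ (t i , t∈N i , inj₂ (adjacent⇒attacks a))

  module _ {k} (bounded : InDegreeBoundedBy F k) where

    undefended⇒refutation : ∀ {S x y} → NAIV S → y ∈ S → Attacks x y → x ∉ S ⁺ →
      Σ[ t ∈ (Fin (suc k) → Fin args) ] ∀ z → Refutes adjacent x t z
    undefended⇒refutation {S} {x} {y} naive y∈S x→y x∉S⁺ = t , refutes
      where
      independent : Independent S
      independent = conflictFree⇒independent (proj₁ naive)
      -- Made total so that it applies to padded indices as well: wherever no conflict with `S` has
      -- to be exhibited, `y` serves as a placeholder in `S`.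
      blocker : ∀ z → ∃[ s ] s ∈ S × (Attacks z x → Attacks z z ⊎ Conflicts z s)
      blocker z with z ∈? S
      ... | yes z∈S = y , y∈S , λ z→x → contradiction (∈⁺ z∈S z→x) x∉S⁺
      ... | no z∉S with naive⇒blocked naive z∉S
      ... | inj₁ z→z = y , y∈S , λ _ → inj₁ z→z
      ... | inj₂ (s , s∈S , c) = s , s∈S , λ _ → inj₂ c
      -- Padding by `x` is harmless, since `blocker x` still yields a member of `S`.
      enumeration = enumerate (⁅ x ⁆ ⁻) (bounded x) x
      t : Fin (suc k) → Fin args
      t zero = y
      t (suc i) = proj₁ (blocker (proj₁ enumeration i))
      t∈S : ∀ i → t i ∈ S
      t∈S zero = y∈S
      t∈S (suc i) = proj₁ (proj₂ (blocker (proj₁ enumeration i)))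
      refutes : ∀ z → Refutes adjacent x t z
      refutes z = attacks⇒adjacent x→y , (λ i j a → independent (t∈S i) (t∈S j) (adjacent⇒attacks a)) , excluded
        where
        excluded : T (adjacent z x) → T (adjacent z z) ⊎ ∃[ i ] (T (adjacent z (t i)) ⊎ T (adjacent (t i) z))
        excluded a with proj₂ enumeration (∈⁻ (x∈⁅x⁆ x) (adjacent⇒attacks a))
        ... | i , refl with proj₂ (proj₂ (blocker (proj₁ enumeration i))) (adjacent⇒attacks a)
        ... | inj₁ z→z = inj₁ (attacks⇒adjacent z→z)
        ... | inj₂ (inj₁ z→t) = inj₂ (suc i , inj₁ (attacks⇒adjacent z→t))
        ... | inj₂ (inj₂ t→z) = inj₂ (suc i , inj₂ (attacks⇒adjacent t→z))

    ¬refutation⇒bijective :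
      (∀ x (t : Fin (suc k) → Fin args) → ¬ (∀ z → Refutes adjacent x t z)) → NaiveBijective F
    ¬refutation⇒bijective none = naive⇒pref , pref⇒naive
      where
      defends : ∀ {S} → NAIV S → S ⁻ ⊆ S ⁺
      defends {S} naive {x} x∈S⁻ with x ∈? S ⁺
      ... | yes x∈S⁺ = x∈S⁺
      ... | no x∉S⁺ =
        let y , y∈S , x→y = ∈⁻⇒ S x∈S⁻ ; t , refutes = undefended⇒refutation naive y∈S x→y x∉S⁺
        in ⊥-elim (none x t refutes)
      naive⇒pref : ∀ {S} → NAIV S → PREF S
      naive⇒pref naive@(cf , max) = (cf , defends naive) , λ U adm → max U (proj₁ adm)
      -- A conflict-free superset `U` of `S` extends to a naive `N`, which is admissible by
      -- `defends`; maximality of `S` among admissible sets then collapses `S ⊆ U ⊆ N`.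
      pref⇒naive : ∀ {S} → PREF S → NAIV S
      pref⇒naive {S} ((cf , _) , max) = cf , maximal
        where
        maximal : ∀ U → ConflictFree U → S ⊆ U → S ≡ U
        maximal U cfU S⊆U =
          let N , naive , U⊆N = independent⊆naive (conflictFree⇒independent cfU)
              S≡N = max N (proj₁ naive , defends naive) (U⊆N ∘ S⊆U)
          in ⊆-antisym S⊆U (subst (U ⊆_) (sym S≡N) U⊆N)

-- A while language for Turing machines

Sym : Set
Sym = Symbol 0

isOne : Sym → Bool
isOne (bit b) = b
isOne _ = false

nonblank : Sym → Bool
nonblank blank = false
nonblank _ = true

module Language (w : ℕ) where

  Tapes Heads : Set
  Tapes = Vec (Tape 0) (suc w)
  Heads = Vec Sym (suc w)

  heads : Tapes → Heads
  heads = Vec.map Tape.head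

  data Program : Set where
    perform : (Heads → Vec (Sym × Move) (suc w)) → Program
    _⨾_     : Program → Program → Program
    while   : (Heads → Bool) → Program → Program

  infixr 5 _⨾_

  data _⊢_⇒[_]_ : Program → Tapes → ℕ → Tapes → Set where
    performed : ∀ {a ts} → perform a ⊢ ts ⇒[ 1 ] Vec.zipWith act (a (heads ts)) ts
    chained   : ∀ {p q ts ts′ ts″ s t} → p ⊢ ts ⇒[ s ] ts′ → q ⊢ ts′ ⇒[ t ] ts″ →
                (p ⨾ q) ⊢ ts ⇒[ s + t ] ts″
    stopped   : ∀ {c p ts} → c (heads ts) ≡ false → while c p ⊢ ts ⇒[ 1 ] ts
    repeated  : ∀ {c p ts ts′ ts″ s t} → c (heads ts) ≡ true →
                p ⊢ ts ⇒[ s ] ts′ → while c p ⊢ ts′ ⇒[ t ] ts″ →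
                while c p ⊢ ts ⇒[ suc (s + t) ] ts″

  -- Control points: one per action and one per loop test. Sequencing adds none, so it costs no
  -- step.
  Location : Program → Set
  Location (perform _) = ⊤
  Location (p ⨾ q)     = Location p ⊎ Location q
  Location (while _ p) = ⊤ ⊎ Location p

  locations : Program → ℕ
  locations (perform _) = 1
  locations (p ⨾ q)     = locations p + locations q
  locations (while _ p) = 1 + locations p

  location↔ : ∀ p → Location p ↔ Fin (locations p)
  location↔ (perform _) = ↔-sym 1↔⊤
  location↔ (p ⨾ q)     = ↔-sym +↔⊎ ↔-∘ (location↔ p ⊎-↔ location↔ q)
  location↔ (while _ p) = ↔-sym +↔⊎ ↔-∘ (↔-sym 1↔⊤ ⊎-↔ location↔ p)

  entry : ∀ p → Location p
  entry (perform _) = tt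
  entry (p ⨾ q)     = inj₁ (entry p)
  entry (while _ p) = inj₁ tt

  idle : Heads → Vec (Sym × Move) (suc w)
  idle = Vec.map (_, stay)

  zipWith-idle : ∀ ts → Vec.zipWith act (idle (heads ts)) ts ≡ ts
  zipWith-idle ts = go ts
    where
    go : ∀ {n} (ts : Vec (Tape 0) n) → Vec.zipWith act (Vec.map (_, stay) (Vec.map Tape.head ts)) ts ≡ ts
    go [] = refl
    go (t ∷ ts) = cong (t ∷_) (go ts)

  -- The code of a program is relative to the embedding of its locations
  -- into the states of a machine and to the control reached on exit.
  code : ∀ {Q : Set} p → (Location p → Q) → Control Q → Location p → Heads → Control Q × Vec (Sym × Move) (suc w)
  code (perform a) emb exit tt       h = exit , a h
  code (p ⨾ q)     emb exit (inj₁ l) h = code p (emb ∘ inj₁) (continue (emb (inj₂ (entry q)))) l h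
  code (p ⨾ q)     emb exit (inj₂ l) h = code q (emb ∘ inj₂) exit l h
  code (while c p) emb exit (inj₁ tt) h =
    (if c h then continue (emb (inj₂ (entry p))) else exit) , idle h
  code (while c p) emb exit (inj₂ l) h = code p (emb ∘ inj₂) (continue (emb (inj₁ tt))) l h

  -- The additional state `inj₁ tt` is the exit of the program; it spends one more step on reading
  -- the verdict off the heads.
  compile : Program → (Heads → Bool) → TuringMachine
  compile p verdict = record
    { State       = ⊤ ⊎ Location p
    ; stateCount  = 1 + locations p
    ; stateFinite = ↔-sym +↔⊎ ↔-∘ (↔-sym 1↔⊤ ⊎-↔ location↔ p)
    ; start       = inj₂ (entry p)
    ; auxSymbols  = 0
    ; workTapes   = w
    ; δ = λ { (inj₁ tt) h → halt (verdict h) , idle h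
            ; (inj₂ l)  h → code p inj₂ (continue (inj₁ tt)) l h }
    }

  module _ (main : Program) (verdict : Heads → Bool) where
    open TuringMachine (compile main verdict)

    -- Continuation style: the run after the exit is a hypothesis. The second half of a sequence, or
    -- the remaining rounds of a loop, can thus be passed as the continuation of the first part, and
    -- the induction follows the derivation of the run.
    simulate : ∀ {p} (emb : Location p → State) (exit : Control State) →
               (∀ l h → δ (emb l) h ≡ code p emb exit l h) →
               ∀ {ts ts′ s t b} → p ⊢ ts ⇒[ s ] ts′ → (exit , ts′) ⇓[ t ] b →
               (continue (emb (entry p)) , ts) ⇓[ s + t ] b
    simulate emb exit coded {ts} {b = b} performed halts =
      stepped (subst (λ d → (proj₁ d , Vec.zipWith act (proj₂ d) ts) ⇓[ _ ] b) (sym (coded tt _)) halts)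
    simulate {p ⨾ q} emb exit coded {ts} {b = b} (chained {s = s} {t = t} run₁ run₂) halts =
      subst ((continue (emb (inj₁ (entry p))) , ts) ⇓[_] b) (sym (ℕ.+-assoc s t _))
        (simulate (emb ∘ inj₁) _ (coded ∘ inj₁) run₁ (simulate (emb ∘ inj₂) exit (coded ∘ inj₂) run₂ halts))
    simulate {while c p} emb exit coded {ts} {t = t} {b} (stopped false!) halts = stepped
      (subst (_⇓[ t ] b) (sym (trans (cong (λ d → proj₁ d , Vec.zipWith act (proj₂ d) ts) (coded (inj₁ tt) _))
        (cong₂ _,_ (cong (if_then continue (emb (inj₂ (entry p))) else exit) false!) (zipWith-idle ts)))) halts)
    simulate {while c p} emb exit coded {ts} {b = b} (repeated {s = s} {t = t} true! run rest) halts = stepped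
      (subst₂ (_⇓[_] b) (sym (trans (cong (λ d → proj₁ d , Vec.zipWith act (proj₂ d) ts) (coded (inj₁ tt) _))
        (cong₂ _,_ (cong (if_then continue (emb (inj₂ (entry p))) else exit) true!) (zipWith-idle ts))))
        (sym (ℕ.+-assoc s t _))
        (simulate (emb ∘ inj₂) _ (coded ∘ inj₂) run (simulate emb exit coded rest halts)))

    compile-correct : ∀ {ts ts′ t} → main ⊢ ts ⇒[ t ] ts′ →
                      (continue start , ts) ⇓[ t + 1 ] verdict (heads ts′)
    compile-correct run = simulate inj₂ (continue (inj₁ tt)) (λ _ _ → refl) run (stepped halted)

  -- Total correctness with a bound on the running time

  record Triple (I : Pred Tapes 0ℓ) (p : Program) (J : Pred Tapes 0ℓ) (T : ℕ) : Set where
    constructor triple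
    field
      execute : ∀ {ts} → I ts → ∃[ ts′ ] ∃[ t ] t ≤ T × p ⊢ ts ⇒[ t ] ts′ × J ts′

  open Triple public

  syntax Triple I p J T = ⟪ I ⟫ p ⟪ J ⟫≤ T

  triple-⨾ : ∀ {I J K p q S T} → ⟪ I ⟫ p ⟪ J ⟫≤ S → ⟪ J ⟫ q ⟪ K ⟫≤ T → ⟪ I ⟫ p ⨾ q ⟪ K ⟫≤ (S + T)
  triple-⨾ f g = triple λ i →
    let _ , s , s≤S , run₁ , j = execute f i
        _ , t , t≤T , run₂ , k = execute g j
    in _ , s + t , ℕ.+-mono-≤ s≤S t≤T , chained run₁ run₂ , k

  weaken : ∀ {I I′ J J′ p T} → (∀ {ts} → I ts → I′ ts) → (∀ {ts} → J′ ts → J ts) →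
           ⟪ I′ ⟫ p ⟪ J′ ⟫≤ T → ⟪ I ⟫ p ⟪ J ⟫≤ T
  weaken pre post f = triple λ i →
    let _ , t , t≤T , run , j = execute f (pre i) in _ , t , t≤T , run , post j

  -- The invariant sees both the rounds done and the rounds left, so upward and downward counts are
  -- expressed without subtraction. Each round pays one extra step for its test, and the final test
  -- accounts for the `+ 1`.
  triple-while : ∀ {c p T} (I : ℕ → ℕ → Pred Tapes 0ℓ) L →
    (∀ a b → a + suc b ≡ L → ⟪ I a (suc b) ⟫ p ⟪ I (suc a) b ⟫≤ T) →
    (∀ a b → a + suc b ≡ L → ∀ {ts} → I a (suc b) ts → c (heads ts) ≡ true) →
    (∀ {ts} → I L 0 ts → c (heads ts) ≡ false) →
    ⟪ I 0 L ⟫ while c p ⟪ I L 0 ⟫≤ (L * suc T + 1)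
  triple-while {c} {p} {T} I L body goes stops = go 0 L refl
    where
    go : ∀ a b → a + b ≡ L → ⟪ I a b ⟫ while c p ⟪ I L 0 ⟫≤ (b * suc T + 1)
    go a zero a≡L rewrite trans (sym (ℕ.+-identityʳ a)) a≡L = triple λ i →
      _ , 1 , ℕ.≤-refl , stopped (stops i) , i
    go a (suc b) eq = triple λ i →
      let _ , s , s≤T , run₁ , j = execute (body a b eq) i
          _ , t , t≤  , run₂ , k = execute (go (suc a) b (trans (sym (ℕ.+-suc a b)) eq)) j
      in _ , suc (s + t)
       , s≤s (ℕ.≤-trans (ℕ.+-mono-≤ s≤T t≤) (ℕ.≤-reflexive (sym (ℕ.+-assoc T (b * suc T) 1))))
       , repeated (goes a b eq i) run₁ run₂ , k

-- Tapes as functions of the cell position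

Behind : (ℕ → Sym) → ℕ → List Sym → Set
Behind f zero    l = ⊤
Behind f (suc p) l = proj₁ (uncons l) ≡ f p × Behind f p (proj₂ (uncons l))

nth : List Sym → ℕ → Sym
nth []       _       = blank
nth (s ∷ ss) zero    = s
nth (s ∷ ss) (suc i) = nth ss i

-- The tape reads f 0, f 1, f 2, …, and the head is on f p. Nothing is
-- said about the cells left of f 0.
record Shows (f : ℕ → Sym) (p : ℕ) (t : Tape 0) : Set where
  constructor shows
  field
    behind : Behind f p (Tape.left t)
    under  : Tape.head t ≡ f p
    ahead  : ∀ i → nth (Tape.right t) i ≡ f (i + suc p)

-- A left move demands a positive position, because nothing is known about the cells left of cell 0.
-- Equations in the constructors allow arbitrary expressions as positions.
data Moves : Move → ℕ → ℕ → Set where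
  left  : ∀ {p p′} → p ≡ suc p′ → Moves goLeft p p′
  still : ∀ {p p′} → p ≡ p′ → Moves stay p p′
  right : ∀ {p p′} → p′ ≡ suc p → Moves goRight p p′

behind-cong : ∀ {f f′} p {l} → (∀ q → q < p → f q ≡ f′ q) → Behind f p l → Behind f′ p l
behind-cong zero    eq _       = tt
behind-cong (suc p) eq (e , b) = trans e (eq p ℕ.≤-refl) , behind-cong p (λ q q<p → eq q (ℕ.m≤n⇒m≤1+n q<p)) b

head-nth : ∀ r → proj₁ (uncons r) ≡ nth r 0
head-nth []      = refl
head-nth (_ ∷ _) = refl

tail-nth : ∀ r i → nth (proj₂ (uncons r)) i ≡ nth r (suc i)
tail-nth []      i = refl
tail-nth (_ ∷ _) i = refl

write-shows : ∀ {f f′ p s t} → f′ p ≡ s → (∀ q → q ≢ p → f q ≡ f′ q) → Shows f p t → Shows f′ p (write s t)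
write-shows {p = p} written kept (shows behind _ ahead) = shows
  (behind-cong p (λ q q<p → kept q (ℕ.<⇒≢ q<p)) behind)
  (sym written)
  (λ i → trans (ahead i) (kept _ (λ eq → ℕ.<⇒≢ (ℕ.m≤n+m (suc p) i) (sym eq))))

move-shows : ∀ {f d p p′ t} → Moves d p p′ → Shows f p t → Shows f p′ (move d t)
move-shows {f} (left refl) (shows (e , behind) under ahead) = shows behind e
  λ { zero → under ; (suc i) → trans (ahead i) (cong f (ℕ.+-suc i _)) }
move-shows (still refl) s = s
move-shows {f} {p = p} {t = tape l s r} (right refl) (shows behind under ahead) = shows (under , behind)
  (trans (head-nth r) (ahead 0))
  (λ i → trans (tail-nth r i) (trans (ahead (suc i)) (cong f (sym (ℕ.+-suc i (suc p))))))

record Effect (a : Sym × Move) (f : ℕ → Sym) (p : ℕ) (f′ : ℕ → Sym) (p′ : ℕ) : Set where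
  constructor effect
  field
    written : f′ p ≡ proj₁ a
    kept    : ∀ q → q ≢ p → f q ≡ f′ q
    moved   : Moves (proj₂ a) p p′

keeping : ∀ {s d f p p′} → s ≡ f p → Moves d p p′ → Effect (s , d) f p f p′
keeping s≡fp moves = effect (sym s≡fp) (λ _ _ → refl) moves

act-shows : ∀ {a f p f′ p′ t} → Effect a f p f′ p′ → Shows f p t → Shows f′ p′ (act a t)
act-shows (effect written kept moved) = move-shows moved ∘ write-shows written kept

emptyTape-shows : Shows (λ _ → blank) 0 emptyTape
emptyTape-shows = shows tt refl (λ _ → refl)

wordTape-shows : ∀ w → Shows (nth (List.map bit w)) 0 (wordTape w)
wordTape-shows []      = emptyTape-shows
wordTape-shows (_ ∷ w) = shows tt refl (λ i → cong (nth (bit _ ∷ List.map bit w)) (sym (ℕ.+-comm i 1)))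

-- Exhaustive search over valuations of finitely many variables

shows-cong : ∀ {f f′ p p′ t} → (∀ q → f q ≡ f′ q) → p ≡ p′ → Shows f p t → Shows f′ p′ t
shows-cong {p = p} f≗f′ refl (shows behind under ahead) =
  shows (behind-cong p (λ q _ → f≗f′ q) behind) (trans under (f≗f′ _)) (λ i → trans (ahead i) (f≗f′ _))

-- One round trip suffices: `each` builds its vector of actions through `unslot`, and the vector is
-- inspected at slots only.
module Named {w : ℕ} {Ix : Set} (slot : Ix → Fin (suc w)) (unslot : Fin (suc w) → Ix)
             (unslot-slot : ∀ x → unslot (slot x) ≡ x) where

  open Language w

  opaque
    read : Heads → Ix → Sym
    read h x = lookup h (slot x)

    _!_ : Tapes → Ix → Tape 0
    ts ! x = lookup ts (slot x)

    each : ((Ix → Sym) → Ix → Sym × Move) → Program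
    each σ = perform (λ h → tabulate (σ (read h) ∘ unslot))

  record Holds (C : Ix → ℕ → Sym) (P : Ix → ℕ) (ts : Tapes) : Set where
    constructor holds
    field
      shown : ∀ x → Shows (C x) (P x) (ts ! x)

  open Holds public

  holds-cong : ∀ {C P P′ ts} → (∀ x → P x ≡ P′ x) → Holds C P ts → Holds C P′ ts
  holds-cong P≗P′ H = holds λ x → shows-cong (λ _ → refl) (P≗P′ x) (shown H x)

  opaque
    unfolding read _!_ each

    read-heads : ∀ ts x → read (heads ts) x ≡ Tape.head (ts ! x)
    read-heads ts x = Vec.lookup-map (slot x) Tape.head ts

    each-! : ∀ σ ts → ∃[ ts′ ] each σ ⊢ ts ⇒[ 1 ] ts′ × (∀ x → ts′ ! x ≡ act (σ (read (heads ts)) x) (ts ! x))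
    each-! σ ts = _ , performed , λ x →
      trans (Vec.lookup-zipWith act (slot x) (tabulate (σ (read (heads ts)) ∘ unslot)) ts)
        (cong (λ a → act a (lookup ts (slot x)))
          (trans (Vec.lookup∘tabulate (σ (read (heads ts)) ∘ unslot) (slot x))
                 (cong (σ (read (heads ts))) (unslot-slot x))))

  holds-heads : ∀ {C P ts} → Holds C P ts → ∀ x → read (heads ts) x ≡ C x (P x)
  holds-heads H x = trans (read-heads _ x) (Shows.under (shown H x))

  triple-each : ∀ {C P C′ P′ σ} →
    (∀ h → (∀ x → h x ≡ C x (P x)) → ∀ x → Effect (σ h x) (C x) (P x) (C′ x) (P′ x)) →
    ⟪ Holds C P ⟫ each σ ⟪ Holds C′ P′ ⟫≤ 1
  triple-each {C′ = C′} {P′} {σ} effects = triple λ {ts} H →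
    let ts′ , run , result = each-! σ ts in
    ts′ , 1 , ℕ.≤-refl , run , holds λ x →
      subst (Shows (C′ x) (P′ x)) (sym (result x))
        (act-shows (effects (read (heads ts)) (holds-heads H) x) (shown H x))

  shift : (Ix → Move) → Program
  shift D = each (λ h x → h x , D x)

  triple-shift : ∀ {C P P′ D} → (∀ x → Moves (D x) (P x) (P′ x)) →
                 ⟪ Holds C P ⟫ shift D ⟪ Holds C P′ ⟫≤ 1
  triple-shift moves = triple-each (λ h h≡ x → keeping (h≡ x) (moves x))

  shiftSet : (Ix → Bool) → Move → Program
  shiftSet X d = shift (λ x → if X x then d else stay)

  at : (Ix → Bool) → ℕ → (Ix → ℕ) → Ix → ℕ
  at X p P x = if X x then p else P x

  triple-shiftSet : ∀ {C P d p p′} X → Moves d p p′ →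
                    ⟪ Holds C (at X p P) ⟫ shiftSet X d ⟪ Holds C (at X p′ P) ⟫≤ 1
  triple-shiftSet {C} {P} {d} {p} {p′} X moves = triple-shift move-one
    where
    move-one : ∀ x → Moves (if X x then d else stay) (at X p P x) (at X p′ P x)
    move-one x with X x
    ... | true = moves
    ... | false = still refl

  untilBlank : Ix → Program → Program
  untilBlank r = while (λ h → nonblank (read h r))

  -- The heads in `X` start together on the blank just after the contents, so watching `r` alone is
  -- enough. The first move enters the contents, the loop stops on the blank cell 0, and the last
  -- move returns to cell 1.
  rewind : (Ix → Bool) → Ix → Program
  rewind X r = shiftSet X goLeft ⨾ untilBlank r (shiftSet X goLeft) ⨾ shiftSet X goRight

  rewindTime : ℕ → ℕ
  rewindTime L = 1 + (L * 2 + 1 + 1)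

  triple-rewind : ∀ {C P} X {r} L → X r ≡ true → C r 0 ≡ blank → (∀ b → b < L → nonblank (C r (suc b)) ≡ true) →
    ⟪ Holds C (at X (suc L) P) ⟫ rewind X r ⟪ Holds C (at X 1 P) ⟫≤ rewindTime L
  triple-rewind {C} {P} X {r} L r∈X start filled =
    triple-⨾ (triple-shiftSet X (left refl))
      (triple-⨾ (triple-while (λ _ b → Holds C (at X b P)) L
                  (λ _ _ _ → triple-shiftSet X (left refl))
                  (λ { a b refl H → trans (cong nonblank (trans (holds-heads H r) (at-r (suc b))))
                                          (filled b (ℕ.m≤n+m (suc b) a)) })
                  (λ H → cong nonblank (trans (holds-heads H r) (trans (at-r 0) start))))
                (triple-shiftSet X (right refl)))
    where
    at-r : ∀ b → C r (at X b P r) ≡ C r b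
    at-r b = cong (λ x → C r (if x then b else P r)) r∈X

-- Cell 0 stays blank, so that a head returning to the left detects the start.
opaque
  cells : ℕ → (ℕ → Sym) → ℕ → Sym
  cells n f zero    = blank
  cells n f (suc p) = if does (p <? n) then f p else blank

  cells-zero : ∀ {n f} → cells n f 0 ≡ blank
  cells-zero = refl

  cells-inside : ∀ {n f p} → p < n → cells n f (suc p) ≡ f p
  cells-inside {n} {f} {p} p<n = cong (if_then f p else blank) (dec-true (p <? n) p<n)

  cells-outside : ∀ {n f p} → n ≤ p → cells n f (suc p) ≡ blank
  cells-outside {n} {f} {p} n≤p = cong (if_then f p else blank) (dec-false (p <? n) (ℕ.≤⇒≯ n≤p))

  cells-grow : ∀ {a f} q → q ≢ suc a → cells a f q ≡ cells (suc a) f q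
  cells-grow zero _ = refl
  cells-grow {a} {f} (suc p) p≢a with p <? a
  ... | yes p<a = trans (cells-inside {f = f} p<a) (sym (cells-inside {f = f} (ℕ.m≤n⇒m≤1+n p<a)))
  ... | no p≮a = trans (cells-outside {f = f} (ℕ.≮⇒≥ p≮a))
    (sym (cells-outside {f = f} (ℕ.≤∧≢⇒< (ℕ.≮⇒≥ p≮a) (λ eq → p≢a (cong suc (sym eq))))))

cell : Sym → ℕ → Sym
cell s zero    = s
cell s (suc _) = blank

opaque
  upd : ∀ {m} {A : Set} → Fin m → A → (Fin m → A) → Fin m → A
  upd i x f u = if does (u Fin.≟ i) then x else f u

  upd-moves : ∀ {m d x x′} {f : Fin m → ℕ} i → Moves d x x′ → ∀ u →
              Moves (upd i d (λ _ → stay) u) (upd i x f u) (upd i x′ f u)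
  upd-moves i moves u with u Fin.≟ i
  ... | yes _ = moves
  ... | no _ = still refl

  upd-self : ∀ {m} {A : Set} {x : A} {f : Fin m → A} i → upd i x f i ≡ x
  upd-self {x = x} {f} i = cong (if_then x else f i) (dec-true (i Fin.≟ i) refl)

  upd-float : ∀ {m} {A B : Set} (g : A → B) {x : A} {f : Fin m → A} i u → g (upd i x f u) ≡ upd i (g x) (g ∘ f) u
  upd-float g i u = if-float g (does (u Fin.≟ i))

  lookup-upd : ∀ {m} {A : Set} {x : A} (v : Vec A m) i u → lookup (v [ i ]≔ x) u ≡ upd i x (lookup v) u
  lookup-upd v i u with u Fin.≟ i
  ... | yes refl = Vec.lookup∘update i v _
  ... | no u≢i = Vec.lookup∘update′ u≢i v _

moves-suc : ∀ {d p p′} → Moves d p p′ → Moves d (suc p) (suc p′)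
moves-suc (left eq)  = left (cong suc eq)
moves-suc (still eq) = still (cong suc eq)
moves-suc (right eq) = right (cong suc eq)

moves-+ʳ : ∀ {d p p′} c → Moves d p p′ → Moves d (p + c) (p′ + c)
moves-+ʳ c (left eq)  = left (cong (_+ c) eq)
moves-+ʳ c (still eq) = still (cong (_+ c) eq)
moves-+ʳ c (right eq) = right (cong (_+ c) eq)

moves-+ˡ : ∀ {d p p′} c → Moves d p p′ → Moves d (c + p) (c + p′)
moves-+ˡ c (left eq)  = left (trans (cong (c +_) eq) (ℕ.+-suc c _))
moves-+ˡ c (still eq) = still (cong (c +_) eq)
moves-+ˡ c (right eq) = right (trans (cong (c +_) eq) (ℕ.+-suc c _))

m<m+1+n : ∀ m n → m < m + suc n
m<m+1+n m n = ℕ.m<m+n m (s≤s z≤n)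

zeros : ∀ s → Vec ℕ s
zeros s = replicate s 0

-- The largest value is joined last, in the order in which an upward counting loop accumulates its
-- flag.
anyBelow : ℕ → (ℕ → Bool) → Bool
anyBelow zero    β = false
anyBelow (suc n) β = anyBelow n β ∨ β n

-- The head of tape var i stands for the value of the i-th variable, and the
-- head of tape mat i j, a copy of the adjacency matrix, for the entry
-- indexed by the i-th and the j-th variable. Tape sweep holds the number of
-- arguments in unary; one pass over it moves a matrix head by a whole row.
data Ix (m : ℕ) : Set where
  input found refuted sweep : Ix m
  var : Fin m → Ix m
  mat : Fin m → Fin m → Ix m

slot : ∀ {m} → Ix m → Fin (suc (3 + (m + m * m)))
slot input   = zero
slot found   = suc zero
slot refuted = suc (suc zero)
slot sweep   = suc (suc (suc zero))
slot {m} (var i)   = suc (suc (suc (suc (i ↑ˡ (m * m)))))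
slot {m} (mat i j) = suc (suc (suc (suc (m ↑ʳ combine i j))))

unslot : ∀ {m} → Fin (suc (3 + (m + m * m))) → Ix m
unslot zero                   = input
unslot (suc zero)             = found
unslot (suc (suc zero))       = refuted
unslot (suc (suc (suc zero))) = sweep
unslot {m} (suc (suc (suc (suc i)))) = [ var , uncurry mat ∘ remQuot m ]′ (splitAt m i)

unslot-slot : ∀ {m} (x : Ix m) → unslot (slot x) ≡ x
unslot-slot input   = refl
unslot-slot found   = refl
unslot-slot refuted = refl
unslot-slot sweep   = refl
unslot-slot {m} (var i)   rewrite splitAt-↑ˡ m i (m * m) = refl
unslot-slot {m} (mat i j) rewrite splitAt-↑ʳ m (m * m) (combine i j) = cong (uncurry mat) (remQuot-combine i j)

-- The summands follow the programs: `n * 2 + 1` is a loop of `n` one-step rounds, each with its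
-- test, plus the final test.
traverseTime stepTime resetTime : ℕ → ℕ
traverseTime n = (n * 2 + 1) + (1 + (n * 2 + 1 + 1))
stepTime n = traverseTime n + 1
resetTime n = 1 + ((n * suc (stepTime n) + 1) + 1)

forTime : ℕ → ℕ → ℕ
forTime T n = (n * suc (T + stepTime n) + 1) + resetTime n

-- The search program

module Search (r : ℕ) where

  m : ℕ
  m = suc r

  open Language (3 + (m + m * m)) public
  open Named {3 + (m + m * m)} {Ix m} slot unslot unslot-slot public

  isCounter isMatrix isSweep : Ix m → Bool
  isCounter sweep   = true
  isCounter (var _) = true
  isCounter _       = false
  isMatrix (mat _ _) = true
  isMatrix _         = false
  isSweep sweep = true
  isSweep _     = false

  copyTo : (Ix m → Bool) → Program
  copyTo X = each λ { h input → h input , goRight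
                    ; h x     → if X x then (h input , goRight) else (h x , stay) }

  afterInput : Ix m → Move
  afterInput input   = stay
  afterInput found   = stay
  afterInput refuted = stay
  afterInput _       = goRight

  onlyInput : Ix m → Move
  onlyInput input = goRight
  onlyInput _     = stay

  -- The first shift leaves cell 0 of the copies blank. The unary loop ends on the separator, a
  -- `false` bit, which `onlyInput` then skips; matrix entries may be `false` too, so the second
  -- loop tests for blanks instead.
  load : Program
  load = shift afterInput
       ⨾ while (λ h → isOne (read h input)) (copyTo isCounter)
       ⨾ shift onlyInput
       ⨾ while (λ h → nonblank (read h input)) (copyTo isMatrix)
       ⨾ rewind isCounter sweep
       ⨾ rewind isMatrix (mat zero zero)

  rowShift colShift varShift : Fin m → Move → Ix m → Move
  rowShift i d sweep     = goRight
  rowShift i d (mat u _) = upd i d (λ _ → stay) u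
  rowShift i d _         = stay
  colShift i d (var u)   = upd i d (λ _ → stay) u
  colShift i d (mat _ w) = upd i d (λ _ → stay) w
  colShift i d _         = stay
  varShift i d (var u)   = upd i d (λ _ → stay) u
  varShift i d _         = stay

  -- The sweep head crosses `n` cells, and each of these steps carries the row heads one cell along,
  -- `n` cells altogether. The head of `mat i i` is moved both here and by `colShift`.
  traverse : Fin m → Move → Program
  traverse i d = untilBlank sweep (shift (rowShift i d)) ⨾ rewind isSweep sweep

  step-variable : Fin m → Move → Program
  step-variable i d = traverse i d ⨾ shift (colShift i d)

  -- After the initial shift the head of `var i` is on cell `b` when the matrix heads stand for the
  -- value `b`, one less than usual. The blank cell 0 is then met exactly at value 0, and the final
  -- shift restores the offset.
  reset : Fin m → Program
  reset i = shift (varShift i goLeft)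
          ⨾ untilBlank (var i) (step-variable i goLeft)
          ⨾ shift (varShift i goRight)

  for : Fin m → Program → Program
  for i body = untilBlank (var i) (body ⨾ step-variable i goRight) ⨾ reset i

  setFound setRefuted : ((Ix m → Sym) → Bool) → Program
  setFound e   = each λ { h found → bit (e h) , stay ; h x → h x , stay }
  setRefuted e = each λ { h refuted → bit (e h) , stay ; h x → h x , stay }

  opaque
    table : (Fin m → Fin m → Bool) → Vec (Vec Bool m) m
    table α = tabulate (λ u → tabulate (α u))

    table-cong : ∀ {α β} → (∀ u w → α u w ≡ β u w) → table α ≡ table β
    table-cong eq = Vec.tabulate-cong (λ u → Vec.tabulate-cong (eq u))

    lookup-table : ∀ α u w → lookup (lookup (table α) u) w ≡ α u w
    lookup-table α u w =
      trans (cong (λ row → lookup row w) (Vec.lookup∘tabulate (tabulate ∘ α) u)) (Vec.lookup∘tabulate (α u) w)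

  checkTime loadTime searchTime : ℕ → ℕ
  checkTime n = 1 + (forTime 1 n + 1)
  loadTime n = 1 + ((n * 2 + 1) + (1 + ((n * n * 2 + 1) + (rewindTime n + rewindTime (n * n)))))

  nestTime : ∀ {A : Set} → List A → ℕ → ℕ
  nestTime []       n = checkTime n
  nestTime (_ ∷ is) n = forTime (nestTime is n) n

  searchTime n = loadTime n + nestTime (List.allFin r) n

  module _ (ψ : Vec (Vec Bool m) m → Bool) where

    -- Variable zero is the innermost, universally quantified one; `refuted`
    -- records whether some value of it violates ψ.
    refuteOne checkAll : Program
    refuteOne = setRefuted (λ h → isOne (h refuted) ∨ not (ψ (table (λ u w → isOne (h (mat u w))))))
    checkAll = setRefuted (λ _ → false) ⨾ for zero refuteOne
             ⨾ setFound (λ h → isOne (h found) ∨ not (isOne (h refuted)))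

    nest : List (Fin r) → Program
    nest []       = checkAll
    nest (i ∷ is) = for (suc i) (nest is)

    search : Program
    search = load ⨾ nest (List.allFin r)

  -- Correctness of the search program

  module Loaded (n : ℕ) (inp : ℕ → Sym)
           (unary : ∀ p → p < n → inp p ≡ bit true) (separator : inp n ≡ bit false)
           (entries : ∀ p → p < n * n → nonblank (inp (suc n + p)) ≡ true)
           (beyond : ∀ p → n * n ≤ p → inp (suc n + p) ≡ blank) where

    -- `a` and `b` count the cells copied so far to the counter and matrix tapes; `g` and `f` are
    -- the two flags.
    contents : ℕ → ℕ → Sym → Sym → Ix m → ℕ → Sym
    contents a b g f input     = inp
    contents a b g f found     = cell f
    contents a b g f refuted   = cell g
    contents a b g f sweep     = cells a inp
    contents a b g f (var _)   = cells a inp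
    contents a b g f (mat _ _) = cells b (λ p → inp (suc n + p))

    layout : ℕ → ℕ → ℕ → Ix m → ℕ
    layout i s q input     = i
    layout i s q found     = 0
    layout i s q refuted   = 0
    layout i s q sweep     = s
    layout i s q (var _)   = s
    layout i s q (mat _ _) = q

    copy-counters : ∀ {a} → Triple (Holds (contents a 0 blank blank) (layout a (suc a) 1))
                                   (copyTo isCounter)
                                   (Holds (contents (suc a) 0 blank blank) (layout (suc a) (suc (suc a)) 1)) 1
    copy-counters {a} = triple-each λ where
      h h≡ input     → keeping (h≡ input) (right refl)
      h h≡ found     → keeping (h≡ found) (still refl)
      h h≡ refuted   → keeping (h≡ refuted) (still refl)
      h h≡ sweep     → effect (trans (cells-inside ℕ.≤-refl) (sym (h≡ input))) cells-grow (right refl)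
      h h≡ (var _)   → effect (trans (cells-inside ℕ.≤-refl) (sym (h≡ input))) cells-grow (right refl)
      h h≡ (mat i j) → keeping (h≡ (mat i j)) (still refl)

    copy-matrices : ∀ {b} → Triple (Holds (contents n b blank blank) (layout (suc n + b) (suc n) (suc b)))
                                   (copyTo isMatrix)
                                   (Holds (contents n (suc b) blank blank)
                                          (layout (suc n + suc b) (suc n) (suc (suc b)))) 1
    copy-matrices {b} = triple-each λ where
      h h≡ input     → keeping (h≡ input) (right (ℕ.+-suc (suc n) b))
      h h≡ found     → keeping (h≡ found) (still refl)
      h h≡ refuted   → keeping (h≡ refuted) (still refl)
      h h≡ sweep     → keeping (h≡ sweep) (still refl)
      h h≡ (var i)   → keeping (h≡ (var i)) (still refl)
      h h≡ (mat _ _) → effect (trans (cells-inside ℕ.≤-refl) (sym (h≡ input))) cells-grow (right refl)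

    triple-load : Triple (Holds (contents 0 0 blank blank) (layout 0 0 0)) load
                         (Holds (contents n (n * n) blank blank) (layout (suc n + n * n) 1 1)) (loadTime n)
    triple-load =
      triple-⨾ (triple-shift {P′ = layout 0 1 1}
        λ { input → still refl ; found → still refl ; refuted → still refl
          ; sweep → right refl ; (var _) → right refl ; (mat _ _) → right refl })
      (triple-⨾ (triple-while (λ a _ → Holds (contents a 0 blank blank) (layout a (suc a) 1)) n
        (λ _ _ _ → copy-counters)
        (λ { a b refl H → cong isOne (trans (holds-heads H input) (unary a (m<m+1+n a b))) })
        (λ H → cong isOne (trans (holds-heads H input) separator)))
      (triple-⨾ (triple-shift {P′ = layout (suc n + 0) (suc n) 1}
        λ { input → right (cong suc (ℕ.+-identityʳ n)) ; found → still refl ; refuted → still refl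
          ; sweep → still refl ; (var _) → still refl ; (mat _ _) → still refl })
      (triple-⨾ (triple-while (λ b _ → Holds (contents n b blank blank) (layout (suc n + b) (suc n) (suc b))) (n * n)
        (λ _ _ _ → copy-matrices)
        (λ a b eq H → trans (cong nonblank (holds-heads H input)) (entries a (subst (a <_) eq (m<m+1+n a b))))
        (λ H → cong nonblank (trans (holds-heads H input) (beyond (n * n) ℕ.≤-refl))))
      (triple-⨾ (weaken
          (holds-cong
            λ { input → refl ; found → refl ; refuted → refl ; sweep → refl ; (var _) → refl ; (mat _ _) → refl })
          (holds-cong {P′ = layout (suc n + n * n) 1 (suc (n * n))}
            λ { input → refl ; found → refl ; refuted → refl ; sweep → refl ; (var _) → refl ; (mat _ _) → refl })
          (triple-rewind {P = layout (suc n + n * n) 1 (suc (n * n))} isCounter n refl cells-zero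
            (λ b b<n → cong nonblank (trans (cells-inside b<n) (unary b b<n)))))
        (weaken
          (holds-cong
            λ { input → refl ; found → refl ; refuted → refl ; sweep → refl ; (var _) → refl ; (mat _ _) → refl })
          (holds-cong
            λ { input → refl ; found → refl ; refuted → refl ; sweep → refl ; (var _) → refl ; (mat _ _) → refl })
          (triple-rewind {P = layout (suc n + n * n) 1 1} isMatrix (n * n) refl cells-zero
            (λ b b<N → trans (cong nonblank (cells-inside b<N)) (entries b b<N))))))))

    loaded : Sym → Sym → Ix m → ℕ → Sym
    loaded = contents n (n * n)

    -- A matrix position is a sum of a row share and a column share, so that the two phases of
    -- changing a variable act on it independently. The `suc` skips the blank cell 0.
    placed : ℕ → (Fin m → ℕ) → (Fin m → ℕ) → (Fin m → ℕ) → Ix m → ℕ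
    placed s κ ρ χ input     = suc n + n * n
    placed s κ ρ χ found     = 0
    placed s κ ρ χ refuted   = 0
    placed s κ ρ χ sweep     = s
    placed s κ ρ χ (var u)   = κ u
    placed s κ ρ χ (mat u w) = suc (ρ u + χ w)

    positions : Vec ℕ m → Ix m → ℕ
    positions v = placed 1 (suc ∘ lookup v) (λ u → lookup v u * n) (lookup v)

    -- Intermediate positions while the i-th variable changes: k is the position
    -- on its own tape, x and y are its shares in the matrix positions as a row
    -- and as a column index.
    varying : Vec ℕ m → Fin m → ℕ → ℕ → ℕ → ℕ → Ix m → ℕ
    varying v i s k x y = placed s (upd i k (suc ∘ lookup v)) (upd i x (λ u → lookup v u * n)) (upd i y (lookup v))

    positions-update : ∀ v i x y → positions (v [ i ]≔ x) y ≡ varying v i 1 (suc x) (x * n) x y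
    positions-update v i x input     = refl
    positions-update v i x found     = refl
    positions-update v i x refuted   = refl
    positions-update v i x sweep     = refl
    positions-update v i x (var u)   = trans (cong suc (lookup-upd v i u)) (upd-float suc i u)
    positions-update v i x (mat u w) = cong suc (cong₂ _+_
      (trans (cong (_* n) (lookup-upd v i u)) (upd-float (_* n) i u)) (lookup-upd v i w))

    module _ {g f : Sym} (v : Vec ℕ m) (i : Fin m) where

      At : ℕ → ℕ → ℕ → ℕ → Pred Tapes 0ℓ
      At s k x y = Holds (loaded g f) (varying v i s k x y)

      triple-row : ∀ {d s k x x′ y} → Moves d x x′ → ⟪ At s k x y ⟫ shift (rowShift i d) ⟪ At (suc s) k x′ y ⟫≤ 1
      triple-row moves = triple-shift λ where
        input     → still refl
        found     → still refl
        refuted   → still refl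
        sweep     → right refl
        (var _)   → still refl
        (mat u w) → moves-suc (moves-+ʳ _ (upd-moves i moves u))

      triple-col : ∀ {d s k k′ x y y′} → Moves d k k′ → Moves d y y′ →
                   ⟪ At s k x y ⟫ shift (colShift i d) ⟪ At s k′ x y′ ⟫≤ 1
      triple-col moves-k moves-y = triple-shift λ where
        input     → still refl
        found     → still refl
        refuted   → still refl
        sweep     → still refl
        (var u)   → upd-moves i moves-k u
        (mat u w) → moves-suc (moves-+ˡ _ (upd-moves i moves-y w))

      triple-var : ∀ {d s k k′ x y} → Moves d k k′ → ⟪ At s k x y ⟫ shift (varShift i d) ⟪ At s k′ x y ⟫≤ 1
      triple-var moves = triple-shift λ where
        input     → still refl
        found     → still refl
        refuted   → still refl
        sweep     → still refl
        (var u)   → upd-moves i moves u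
        (mat _ _) → still refl

      -- Letting `x` depend on the rounds done and on the rounds left covers both directions:
      -- increments follow the former, decrements the latter.
      triple-traverse : ∀ {d k y} (x : ℕ → ℕ → ℕ) → (∀ a b → Moves d (x a (suc b)) (x (suc a) b)) →
        ⟪ At 1 k (x 0 n) y ⟫ traverse i d ⟪ At 1 k (x n 0) y ⟫≤ traverseTime n
      triple-traverse {k = k} {y} x moves =
        triple-⨾ (triple-while (λ a b → At (suc a) k (x a b) y) n
          (λ a b _ → triple-row (moves a b))
          (λ { a b refl H → cong nonblank (trans (holds-heads H sweep)
                 (trans (cells-inside (m<m+1+n a b)) (unary a (m<m+1+n a b)))) })
          (λ H → cong nonblank (trans (holds-heads H sweep) (cells-outside {f = inp} (ℕ.≤-refl {n})))))
        (weaken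
          (holds-cong
            λ { input → refl ; found → refl ; refuted → refl ; sweep → refl ; (var _) → refl ; (mat _ _) → refl })
          (holds-cong
            λ { input → refl ; found → refl ; refuted → refl ; sweep → refl ; (var _) → refl ; (mat _ _) → refl })
          (triple-rewind {P = varying v i 1 k (x n 0) y} isSweep n refl cells-zero
            (λ b b<n → cong nonblank (trans (cells-inside b<n) (unary b b<n)))))

      triple-increment : ∀ x → ⟪ Holds (loaded g f) (positions (v [ i ]≔ x)) ⟫ step-variable i goRight
                               ⟪ Holds (loaded g f) (positions (v [ i ]≔ suc x)) ⟫≤ stepTime n
      triple-increment x = weaken
        (holds-cong (positions-update v i x)) (holds-cong (sym ∘ positions-update v i (suc x)))
        (triple-⨾ (triple-traverse (λ a _ → a + x * n) (λ _ _ → right refl)) (triple-col (right refl) (right refl)))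

      triple-decrement : ∀ x → ⟪ At 1 (suc x) (suc x * n) (suc x) ⟫ step-variable i goLeft
                               ⟪ At 1 x (x * n) x ⟫≤ stepTime n
      triple-decrement x =
        triple-⨾ (triple-traverse (λ _ b → b + x * n) (λ _ _ → left refl)) (triple-col (left refl) (left refl))

      triple-reset : ⟪ Holds (loaded g f) (positions (v [ i ]≔ n)) ⟫ reset i
                     ⟪ Holds (loaded g f) (positions (v [ i ]≔ 0)) ⟫≤ resetTime n
      triple-reset = weaken (holds-cong (positions-update v i n)) (holds-cong (sym ∘ positions-update v i 0))
        (triple-⨾ (triple-var (left refl))
        (triple-⨾ (triple-while (λ _ b → At 1 b (b * n) b) n
          (λ _ b _ → triple-decrement b)
          (λ { a b refl H → cong nonblank (trans (holds-heads H (var i)) (trans (cong (cells n inp) (upd-self i))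
                 (trans (cells-inside (ℕ.m≤n+m (suc b) a)) (unary b (ℕ.m≤n+m (suc b) a))))) })
          (λ H → cong nonblank (trans (holds-heads H (var i)) (trans (cong (cells n inp) (upd-self i)) cells-zero))))
        (triple-var (right refl))))

    -- The flag symbols stay existential because a cell that is still blank also counts as false;
    -- `Φ` keeps just their Boolean meaning.
    record Flagged (Φ : Bool → Sym → Sym → Set) (v : Vec ℕ m) (b : Bool) (ts : Tapes) : Set where
      constructor flagged
      field
        {flag₁ flag₂} : Sym
        flags : Φ b flag₁ flag₂
        state : Holds (loaded flag₁ flag₂) (positions v) ts

    flagged-triple : ∀ {Φ v v′ b p T} →
      (∀ {g f} → ⟪ Holds (loaded g f) (positions v) ⟫ p ⟪ Holds (loaded g f) (positions v′) ⟫≤ T) →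
      ⟪ Flagged Φ v b ⟫ p ⟪ Flagged Φ v′ b ⟫≤ T
    flagged-triple tr = triple λ { (flagged φ H) →
      let ts , t , t≤T , run , H′ = execute tr H in ts , t , t≤T , run , flagged φ H′ }

    flagged-var : ∀ {Φ v b ts} i → Flagged Φ v b ts → read (heads ts) (var i) ≡ cells n inp (suc (lookup v i))
    flagged-var i (flagged _ H) = holds-heads H (var i)

    -- Body and loop have the same form: each joins a disjunct to an arbitrary incoming flag and
    -- leaves the variable as it was. This is what makes loops nest.
    triple-for : ∀ {Φ β body T} v i →
      (∀ a b → ⟪ Flagged Φ (v [ i ]≔ a) b ⟫ body ⟪ Flagged Φ (v [ i ]≔ a) (b ∨ β a) ⟫≤ T) →
      ∀ b → ⟪ Flagged Φ (v [ i ]≔ 0) b ⟫ for i body ⟪ Flagged Φ (v [ i ]≔ 0) (b ∨ anyBelow n β) ⟫≤ forTime T n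
    triple-for {Φ} {β} v i body b =
      triple-⨾ (weaken (subst (λ c → Flagged Φ _ c _) (sym (∨-identityʳ b))) id
        (triple-while (λ a _ → Flagged Φ (v [ i ]≔ a) (b ∨ anyBelow a β)) n
          (λ a _ _ → triple-⨾ (body a _) (weaken id (subst (λ c → Flagged Φ _ c _) (∨-assoc b _ _))
                                            (flagged-triple (triple-increment v i a))))
          (λ { a c refl H → cong nonblank (trans (flagged-var i H)
                 (trans (cong (cells n inp ∘ suc) (Vec.lookup∘update i v a))
                 (trans (cells-inside (m<m+1+n a c)) (unary a (m<m+1+n a c))))) })
          (λ H → cong nonblank (trans (flagged-var i H)
                 (trans (cong (cells n inp ∘ suc) (Vec.lookup∘update i v n))
                 (cells-outside {f = inp} (ℕ.≤-refl {n})))))))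
      (flagged-triple (triple-reset v i))

    triple-setFound : ∀ {g f P e b} → (∀ h → (∀ x → h x ≡ loaded g f x (P x)) → e h ≡ b) → P found ≡ 0 →
      ⟪ Holds (loaded g f) P ⟫ setFound e ⟪ Holds (loaded g (bit b)) P ⟫≤ 1
    triple-setFound {P = P} value origin = triple-each λ where
      h h≡ input     → keeping (h≡ input) (still refl)
      h h≡ found     → effect (trans (cong (cell _) origin) (cong bit (sym (value h h≡))))
                       (λ { zero 0≢ → contradiction (sym origin) 0≢ ; (suc _) _ → refl }) (still refl)
      h h≡ refuted   → keeping (h≡ refuted) (still refl)
      h h≡ sweep     → keeping (h≡ sweep) (still refl)
      h h≡ (var u)   → keeping (h≡ (var u)) (still refl)
      h h≡ (mat u w) → keeping (h≡ (mat u w)) (still refl)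

    triple-setRefuted : ∀ {g f P e b} → (∀ h → (∀ x → h x ≡ loaded g f x (P x)) → e h ≡ b) → P refuted ≡ 0 →
      ⟪ Holds (loaded g f) P ⟫ setRefuted e ⟪ Holds (loaded (bit b) f) P ⟫≤ 1
    triple-setRefuted {P = P} value origin = triple-each λ where
      h h≡ input     → keeping (h≡ input) (still refl)
      h h≡ refuted   → effect (trans (cong (cell _) origin) (cong bit (sym (value h h≡))))
                       (λ { zero 0≢ → contradiction (sym origin) 0≢ ; (suc _) _ → refl }) (still refl)
      h h≡ found     → keeping (h≡ found) (still refl)
      h h≡ sweep     → keeping (h≡ sweep) (still refl)
      h h≡ (var u)   → keeping (h≡ (var u)) (still refl)
      h h≡ (mat u w) → keeping (h≡ (mat u w)) (still refl)

    adjacency : ℕ → ℕ → Bool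
    adjacency a b = isOne (inp (suc n + (a * n + b)))

    tableAt : Vec ℕ m → Vec (Vec Bool m) m
    tableAt v = table (λ u w → adjacency (lookup v u) (lookup v w))

    table-read : ∀ {g f v} (h : Ix m → Sym) → (∀ x → h x ≡ loaded g f x (positions v x)) →
                 table (λ u w → isOne (h (mat u w))) ≡ tableAt v
    table-read {v = v} h h≡ = table-cong λ u w →
      cong isOne (trans (h≡ (mat u w)) (cells-all (lookup v u * n + lookup v w)))
      where
      -- Past the matrix both sides are blank, so the table is read correctly at all values of the
      -- variables, as the body premise of `triple-for` asks.
      cells-all : ∀ p → cells (n * n) (λ p → inp (suc n + p)) (suc p) ≡ inp (suc n + p)
      cells-all p with p <? n * n
      ... | yes p< = cells-inside p<
      ... | no p≮ = trans (cells-outside (ℕ.≮⇒≥ p≮)) (sym (beyond p (ℕ.≮⇒≥ p≮)))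

    module Nested (ψ : Vec (Vec Bool m) m → Bool) where

      witnessed : Vec ℕ r → Bool
      witnessed v = not (anyBelow n (λ a → not (ψ (tableAt (a ∷ v)))))

      anyNested : List (Fin r) → Vec ℕ r → Bool
      anyNested []       v = witnessed v
      anyNested (i ∷ is) v = anyBelow n (λ a → anyNested is (v [ i ]≔ a))

      FoundIs : Bool → Sym → Sym → Set
      FoundIs b g f = isOne f ≡ b

      -- Within the innermost loop the accumulator is `refuted`, while the outer result `c` in
      -- `found` has to be carried along.
      RefutedIs : Bool → Bool → Sym → Sym → Set
      RefutedIs c b g f = isOne g ≡ b × isOne f ≡ c

      triple-checkAll : ∀ v b → ⟪ Flagged FoundIs (0 ∷ v) b ⟫ checkAll ψ
                                ⟪ Flagged FoundIs (0 ∷ v) (b ∨ witnessed v) ⟫≤ checkTime n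
      triple-checkAll v b =
        triple-⨾ {J = Flagged (RefutedIs b) (0 ∷ v) false} clear
        (triple-⨾ (triple-for {Φ = RefutedIs b} {β = λ a → not (ψ (tableAt (a ∷ v)))} (0 ∷ v) zero refute false)
          record-witness)
        where
        clear : ⟪ Flagged FoundIs (0 ∷ v) b ⟫ setRefuted (λ _ → false) ⟪ Flagged (RefutedIs b) (0 ∷ v) false ⟫≤ 1
        clear = triple λ { (flagged φ H) →
          let ts , t , t≤ , run , H′ = execute (triple-setRefuted {b = false} (λ _ _ → refl) refl) H
          in ts , t , t≤ , run , flagged (refl , φ) H′ }
        refute : ∀ a c → ⟪ Flagged (RefutedIs b) (a ∷ v) c ⟫ refuteOne ψ
                         ⟪ Flagged (RefutedIs b) (a ∷ v) (c ∨ not (ψ (tableAt (a ∷ v)))) ⟫≤ 1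
        refute a c = triple λ { (flagged {g} {f} (refl , φ) H) →
          let ts , t , t≤ , run , H′ = execute (triple-setRefuted
                (λ h h≡ → cong₂ (λ s τ → isOne s ∨ not (ψ τ)) (h≡ refuted) (table-read {g} {f} {a ∷ v} h h≡)) refl) H
          in ts , t , t≤ , run , flagged (refl , φ) H′ }
        record-witness : ⟪ Flagged (RefutedIs b) (0 ∷ v) (anyBelow n (λ a → not (ψ (tableAt (a ∷ v))))) ⟫
                         setFound (λ h → isOne (h found) ∨ not (isOne (h refuted)))
                         ⟪ Flagged FoundIs (0 ∷ v) (b ∨ witnessed v) ⟫≤ 1
        record-witness = triple λ { (flagged (ref , φ) H) →
          let ts , t , t≤ , run , H′ = execute (triple-setFound
                (λ h h≡ → cong₂ (λ x y → x ∨ not y) (trans (cong isOne (h≡ found)) φ)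
                                                    (trans (cong isOne (h≡ refuted)) ref)) refl) H
          in ts , t , t≤ , run , flagged refl H′ }

      -- A loop expects its variable at 0. Uniqueness guarantees that assigning an outer variable
      -- leaves the inner ones at 0.
      triple-nest : ∀ is v b → Unique is → All (λ i → lookup v i ≡ 0) is →
        ⟪ Flagged FoundIs (0 ∷ v) b ⟫ nest ψ is ⟪ Flagged FoundIs (0 ∷ v) (b ∨ anyNested is v) ⟫≤ nestTime is n
      triple-nest []       v b _ _ = triple-checkAll v b
      triple-nest (i ∷ is) v b (i∉is ∷ unique) (v≡0 ∷ zeros) =
        subst (λ u → ⟪ Flagged FoundIs (0 ∷ u) b ⟫ nest ψ (i ∷ is)
                     ⟪ Flagged FoundIs (0 ∷ u) (b ∨ anyNested (i ∷ is) v) ⟫≤ nestTime (i ∷ is) n)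
          (trans (cong (v [ i ]≔_) (sym v≡0)) (Vec.[]≔-lookup v i))
          (triple-for (0 ∷ v) (suc i) (λ a c → triple-nest is (v [ i ]≔ a) c unique (others-zero a i∉is zeros)) b)
        where
        others-zero : ∀ a {js} → All (i ≢_) js → All (λ j → lookup v j ≡ 0) js →
                      All (λ j → lookup (v [ i ]≔ a) j ≡ 0) js
        others-zero a [] [] = []
        others-zero a (i≢j ∷ i≢js) (z ∷ zs) = trans (Vec.lookup∘update′ (i≢j ∘ sym) v a) z ∷ others-zero a i≢js zs

      triple-search : ⟪ Holds (contents 0 0 blank blank) (layout 0 0 0) ⟫ search ψ
                      ⟪ Flagged FoundIs (zeros m) (anyNested (List.allFin r) (zeros r)) ⟫≤ searchTime n
      triple-search = triple-⨾ triple-load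
        (weaken (flagged refl ∘ holds-cong start) id
          (triple-nest (List.allFin r) (zeros r) false (allFin⁺ r) (All.tabulate λ {i} _ → Vec.lookup-replicate i 0)))
        where
        start : ∀ x → layout (suc n + n * n) 1 1 x ≡ positions (zeros m) x
        start input     = refl
        start found     = refl
        start refuted   = refl
        start sweep     = refl
        start (var u)   = cong suc (sym (Vec.lookup-replicate u 0))
        start (mat u w) = cong suc (sym
          (cong₂ (λ x y → x * n + y) (Vec.lookup-replicate u 0) (Vec.lookup-replicate w 0)))

-- Polynomial time bounds

-- Powers of suc n, unlike those of n, are monotone in the exponent even at 0.
PolynomiallyBounded : (ℕ → ℕ) → Set
PolynomiallyBounded f = ∃[ c ] ∃[ d ] ∀ n → f n ≤ c * suc n ^ d

poly-const : ∀ k → PolynomiallyBounded (λ _ → k)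
poly-const k = k , 0 , λ _ → ℕ.≤-reflexive (sym (ℕ.*-identityʳ k))

poly-id : PolynomiallyBounded (λ n → n)
poly-id = 1 , 1 , λ n → ℕ.≤-trans (ℕ.n≤1+n n) (ℕ.≤-reflexive (sym (trans (ℕ.*-identityˡ _) (ℕ.*-identityʳ (suc n)))))

poly-+ : ∀ {f g} → PolynomiallyBounded f → PolynomiallyBounded g → PolynomiallyBounded (λ n → f n + g n)
poly-+ {f} {g} (c , d , f≤) (c′ , d′ , g≤) = c + c′ , d + d′ , λ n → begin
  f n + g n                                      ≤⟨ ℕ.+-mono-≤ (f≤ n) (g≤ n) ⟩
  c * suc n ^ d + c′ * suc n ^ d′                ≤⟨ ℕ.+-mono-≤ (ℕ.*-monoʳ-≤ c (ℕ.^-monoʳ-≤ (suc n) (ℕ.m≤m+n d d′)))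
                                                               (ℕ.*-monoʳ-≤ c′ (ℕ.^-monoʳ-≤ (suc n) (ℕ.m≤n+m d′ d))) ⟩
  c * suc n ^ (d + d′) + c′ * suc n ^ (d + d′)   ≡⟨ ℕ.*-distribʳ-+ (suc n ^ (d + d′)) c c′ ⟨
  (c + c′) * suc n ^ (d + d′)                    ∎
  where open ℕ.≤-Reasoning

poly-* : ∀ {f g} → PolynomiallyBounded f → PolynomiallyBounded g → PolynomiallyBounded (λ n → f n * g n)
poly-* {f} {g} (c , d , f≤) (c′ , d′ , g≤) = c * c′ , d + d′ , λ n → begin
  f n * g n                              ≤⟨ ℕ.*-mono-≤ (f≤ n) (g≤ n) ⟩
  (c * suc n ^ d) * (c′ * suc n ^ d′)    ≡⟨ ℕ.[m*n]*[o*p]≡[m*o]*[n*p] c (suc n ^ d) c′ (suc n ^ d′) ⟩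
  (c * c′) * (suc n ^ d * suc n ^ d′)    ≡⟨ cong (c * c′ *_) (ℕ.^-distribˡ-+-* (suc n) d d′) ⟨
  (c * c′) * suc n ^ (d + d′)            ∎
  where open ℕ.≤-Reasoning

^-distribʳ-* : ∀ a b d → (a * b) ^ d ≡ a ^ d * b ^ d
^-distribʳ-* a b zero    = refl
^-distribʳ-* a b (suc d) = trans (cong (a * b *_) (^-distribʳ-* a b d)) (ℕ.[m*n]*[o*p]≡[m*o]*[n*p] a b (a ^ d) (b ^ d))

-- For positive `s` the bound `suc s ≤ 2 * s` gives the first summand; the constant summand covers
-- `s = 0`.
suc-^-≤ : ∀ s d → suc s ^ d ≤ 2 ^ d * s ^ d + 2 ^ d
suc-^-≤ zero d = begin
  1 ^ d                       ≡⟨ ℕ.^-zeroˡ d ⟩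
  1                           ≤⟨ ℕ.m^n>0 2 d ⟩
  2 ^ d                       ≤⟨ ℕ.m≤n+m (2 ^ d) (2 ^ d * 0 ^ d) ⟩
  2 ^ d * 0 ^ d + 2 ^ d       ∎
  where open ℕ.≤-Reasoning
suc-^-≤ s@(suc s′) d = begin
  suc s ^ d                   ≤⟨ ℕ.^-monoˡ-≤ d (s≤s (ℕ.≤-trans (ℕ.m≤n+m s s′) (ℕ.+-monoʳ-≤ s′ (ℕ.m≤m+n s 0)))) ⟩
  (2 * s) ^ d                 ≡⟨ ^-distribʳ-* 2 s d ⟩
  2 ^ d * s ^ d               ≤⟨ ℕ.m≤m+n _ _ ⟩
  2 ^ d * s ^ d + 2 ^ d       ∎
  where open ℕ.≤-Reasoning

-- Running times are counted in the number of arguments `n`, the final bound in the size `s`; the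
-- majorant `c * suc n ^ d` is monotone in `n`, which permits the exchange.
poly-closed-form : ∀ {f} → PolynomiallyBounded f → ∃[ c ] ∃[ d ] ∀ n s → n ≤ s → f n ≤ c * s ^ d + c
poly-closed-form {f} (c , d , f≤) = c * 2 ^ d , d , λ n s n≤s → begin
  f n                                  ≤⟨ f≤ n ⟩
  c * suc n ^ d                        ≤⟨ ℕ.*-monoʳ-≤ c (ℕ.^-monoˡ-≤ d (s≤s n≤s)) ⟩
  c * suc s ^ d                        ≤⟨ ℕ.*-monoʳ-≤ c (suc-^-≤ s d) ⟩
  c * (2 ^ d * s ^ d + 2 ^ d)          ≡⟨ ℕ.*-distribˡ-+ c (2 ^ d * s ^ d) (2 ^ d) ⟩
  c * (2 ^ d * s ^ d) + c * 2 ^ d      ≡⟨ cong (_+ c * 2 ^ d) (ℕ.*-assoc c (2 ^ d) (s ^ d)) ⟨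
  c * 2 ^ d * s ^ d + c * 2 ^ d        ∎
  where open ℕ.≤-Reasoning

poly-rewind : ∀ {f} → PolynomiallyBounded f → PolynomiallyBounded (λ n → 1 + (f n * 2 + 1 + 1))
poly-rewind p = poly-+ (poly-const 1) (poly-+ (poly-+ (poly-* p (poly-const 2)) (poly-const 1)) (poly-const 1))

poly-step : PolynomiallyBounded stepTime
poly-step = poly-+ (poly-+ (poly-+ (poly-* poly-id (poly-const 2)) (poly-const 1)) (poly-rewind poly-id)) (poly-const 1)

poly-for : ∀ {f} → PolynomiallyBounded f → PolynomiallyBounded (λ n → forTime (f n) n)
poly-for p =
  poly-+ (poly-+ (poly-* poly-id (poly-+ (poly-const 1) (poly-+ p poly-step))) (poly-const 1))
    (poly-+ (poly-const 1)
      (poly-+ (poly-+ (poly-* poly-id (poly-+ (poly-const 1) poly-step)) (poly-const 1)) (poly-const 1)))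

-- Reading Boolean searches and encoded words

anyBelow⁺ : ∀ {n β a} → a < n → T (β a) → T (anyBelow n β)
anyBelow⁺ {suc n} {β} (s≤s a≤n) βa with ℕ.m≤n⇒m<n∨m≡n a≤n
... | inj₁ a<n  = Equivalence.from T-∨ (inj₁ (anyBelow⁺ {β = β} a<n βa))
... | inj₂ refl = Equivalence.from (T-∨ {anyBelow n β}) (inj₂ βa)

anyBelow⁻ : ∀ n {β} → T (anyBelow n β) → ∃[ a ] a < n × T (β a)
anyBelow⁻ (suc n) {β} t with Equivalence.to (T-∨ {anyBelow n β}) t
... | inj₁ below = let a , a<n , βa = anyBelow⁻ n below in a , ℕ.m≤n⇒m≤1+n a<n , βa
... | inj₂ βn    = n , ℕ.≤-refl , βn

T-not⁺ : ∀ {b} → ¬ T b → T (not b)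
T-not⁺ {false} _  = _
T-not⁺ {true}  ¬t = ⊥-elim (¬t _)

T-not⁻ : ∀ {b} → T (not b) → ¬ T b
T-not⁻ {false} _ ()

lookup-injective : ∀ {A : Set} {n} (v w : Vec A n) → (∀ i → lookup v i ≡ lookup w i) → v ≡ w
lookup-injective v w eq = trans (sym (Vec.tabulate∘lookup v)) (trans (Vec.tabulate-cong eq) (Vec.tabulate∘lookup w))

reflects-not : ∀ {P : Set} {b} → (T b → ¬ P) → (¬ T b → P) → Reflects P (not b)
reflects-not {b = true}  ¬p _ = ofⁿ (¬p _)
reflects-not {b = false} _ p  = ofʸ (p id)

refutes-cong : ∀ {V : Set} {ℓ} {α β : V → V → Bool} → (∀ u v → α u v ≡ β u v) →
               ∀ {x} {t : Fin (suc ℓ) → V} {z} → Refutes α x t z → Refutes β x t z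
refutes-cong {ℓ = ℓ} {α} {β} eq {t = t} {z} (x→t , free , excluded) =
  subst T (eq _ _) x→t , (λ i j a → free i j (subst T (sym (eq _ _)) a)) ,
  λ z→x → transport (excluded (subst T (sym (eq _ _)) z→x))
  where
  transport : T (α z z) ⊎ ∃[ i ] (T (α z (t i)) ⊎ T (α (t i) z)) → T (β z z) ⊎ ∃[ i ] (T (β z (t i)) ⊎ T (β (t i) z))
  transport (inj₁ a) = inj₁ (subst T (eq _ _) a)
  transport (inj₂ (i , inj₁ a)) = inj₂ (i , inj₁ (subst T (eq _ _) a))
  transport (inj₂ (i , inj₂ a)) = inj₂ (i , inj₂ (subst T (eq _ _) a))

nth-replicate : ∀ n r p → p < n → nth (List.map bit (List.replicate n true ++ r)) p ≡ bit true
nth-replicate (suc n) r zero    _         = refl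
nth-replicate (suc n) r (suc p) (s≤s p<n) = nth-replicate n r p p<n

nth-after-replicate : ∀ n r p → nth (List.map bit (List.replicate n true ++ r)) (n + p) ≡ nth (List.map bit r) p
nth-after-replicate zero    r p = refl
nth-after-replicate (suc n) r p = nth-after-replicate n r p

nth-toList : ∀ {n} (v : Vec Bool n) i → nth (List.map bit (Vec.toList v)) (toℕ i) ≡ bit (lookup v i)
nth-toList (_ ∷ v) zero    = refl
nth-toList (_ ∷ v) (suc i) = nth-toList v i

nth-beyond : ∀ {n} (v : Vec Bool n) p → n ≤ p → nth (List.map bit (Vec.toList v)) p ≡ blank
nth-beyond []      p       _         = refl
nth-beyond (_ ∷ v) (suc p) (s≤s n≤p) = nth-beyond v p n≤p

-- The machine for a fixed degree bound

module Decision (k : ℕ) where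

  -- The `2 + k` outer variables are `x` and the `k + 1` witnesses; the innermost variable zero is
  -- `z`.
  open Search (2 + k)

  relation : Vec (Vec Bool m) m → Fin m → Fin m → Bool
  relation τ u v = lookup (lookup τ u) v

  -- The variables themselves act as vertices, and `τ` is the attack relation pulled back along the
  -- valuation. Two variables with equal values need no special treatment.
  RefutesZero : Vec (Vec Bool m) m → Set
  RefutesZero τ = Refutes (relation τ) (suc zero) (λ (i : Fin (suc k)) → suc (suc i)) zero

  opaque
    test : Vec (Vec Bool m) m → Bool
    test τ = isYes (refutes? (relation τ) (suc zero) (λ (i : Fin (suc k)) → suc (suc i)) zero)

    test-sound : ∀ τ → T (test τ) → RefutesZero τ
    test-sound τ = toWitness

    test-complete : ∀ τ → RefutesZero τ → T (test τ)
    test-complete τ = fromWitness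

  verdict : Heads → Bool
  verdict h = not (isOne (read h found))

  machine : TuringMachine
  machine = compile (search test) verdict

  open TuringMachine machine using (initial; _⇓[_]_)

  poly-search : PolynomiallyBounded searchTime
  poly-search = poly-+
    (poly-+ (poly-const 1) (poly-+ (poly-+ (poly-* poly-id (poly-const 2)) (poly-const 1))
      (poly-+ (poly-const 1) (poly-+ (poly-+ (poly-* (poly-* poly-id poly-id) (poly-const 2)) (poly-const 1))
        (poly-+ (poly-rewind poly-id) (poly-rewind (poly-* poly-id poly-id)))))))
    (poly-nest (List.allFin (2 + k)))
    where
    poly-nest : ∀ {A : Set} (is : List A) → PolynomiallyBounded (nestTime is)
    poly-nest []       = poly-+ (poly-const 1) (poly-+ (poly-for (poly-const 1)) (poly-const 1))
    poly-nest (_ ∷ is) = poly-for (poly-nest is)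

  module _ (F : AF) where
    open AF F hiding (size; NaiveBijective; InDegreeBoundedBy)

    n : ℕ
    n = args

    inp : ℕ → Sym
    inp = nth (List.map bit (encode F))

    after-unary : ∀ p → inp (suc n + p) ≡ nth (List.map bit (Vec.toList (Vec.concat matrix))) p
    after-unary p = trans (cong inp (sym (ℕ.+-suc n p))) (nth-after-replicate n _ (suc p))

    unary : ∀ p → p < n → inp p ≡ bit true
    unary = nth-replicate n _

    separator : inp n ≡ bit false
    separator = trans (cong inp (sym (ℕ.+-identityʳ n))) (nth-after-replicate n _ 0)

    entries : ∀ p → p < n * n → nonblank (inp (suc n + p)) ≡ true
    entries p p< = cong nonblank (trans (after-unary p)
      (trans (cong (nth (List.map bit (Vec.toList (Vec.concat matrix)))) (sym (toℕ-fromℕ< p<)))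
        (nth-toList (Vec.concat matrix) (fromℕ< p<))))

    beyond : ∀ p → n * n ≤ p → inp (suc n + p) ≡ blank
    beyond p n*n≤p = trans (after-unary p) (nth-beyond (Vec.concat matrix) p n*n≤p)

    open Loaded n inp unary separator entries beyond
    open Nested test

    adj-adjacent : ∀ x y → adjacency (toℕ x) (toℕ y) ≡ adjacent F x y
    adj-adjacent x y = cong isOne (begin
      inp (suc n + (toℕ x * n + toℕ y))                                        ≡⟨ after-unary _ ⟩
      nth bits (toℕ x * n + toℕ y)       ≡⟨ cong (λ s → nth bits (s + toℕ y)) (ℕ.*-comm (toℕ x) n) ⟩
      nth bits (n * toℕ x + toℕ y)       ≡⟨ cong (nth bits) (toℕ-combine x y) ⟨
      nth bits (toℕ (combine x y))       ≡⟨ nth-toList (Vec.concat matrix) (combine x y) ⟩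
      bit (lookup (Vec.concat matrix) (combine x y)) ≡⟨ cong bit (Vec.lookup-concat matrix x y) ⟩
      bit (adjacent F x y)               ∎)
      where
      open ≡-Reasoning
      bits = List.map bit (Vec.toList (Vec.concat matrix))

    record Represents {s} (v : Vec ℕ s) (val : Fin s → Fin n) : Set where
      constructor represents
      field
        value : ∀ i → lookup v i ≡ toℕ (val i)

    IsRefutation : (Fin (2 + k) → Fin n) → Set
    IsRefutation val = ∀ z → Refutes (adjacent F) (val zero) (λ (i : Fin (suc k)) → val (suc i)) z

    extend : Fin n → (Fin (2 + k) → Fin n) → Fin m → Fin n
    extend z val zero    = z
    extend z val (suc i) = val i

    relation-table : ∀ {v val} → Represents v val → ∀ z u w →
                     relation (tableAt (toℕ z ∷ v)) u w ≡ adjacent F (extend z val u) (extend z val w)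
    relation-table {v} {val} (represents rep) z u w = begin
      lookup (lookup (tableAt v′) u) w                          ≡⟨ lookup-table _ u w ⟩
      adjacency (lookup v′ u) (lookup v′ w)            ≡⟨ cong₂ adjacency (rep′ u) (rep′ w) ⟩
      adjacency (toℕ (extend z val u)) (toℕ (extend z val w))  ≡⟨ adj-adjacent _ _ ⟩
      adjacent F (extend z val u) (extend z val w) ∎
      where
      open ≡-Reasoning
      v′ = toℕ z ∷ v
      rep′ : ∀ i → lookup v′ i ≡ toℕ (extend z val i)
      rep′ zero    = refl
      rep′ (suc i) = rep i

    test⁺ : ∀ {v val z} → Represents v val → Refutes (adjacent F) (val zero) (λ (i : Fin (suc k)) → val (suc i)) z →
            T (test (tableAt (toℕ z ∷ v)))
    test⁺ {v} {z = z} rep refutes = test-complete (tableAt (toℕ z ∷ v))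
      (refutes-cong (λ u w → sym (relation-table rep z u w)) refutes)

    test⁻ : ∀ {v val z} → Represents v val → T (test (tableAt (toℕ z ∷ v))) →
            Refutes (adjacent F) (val zero) (λ (i : Fin (suc k)) → val (suc i)) z
    test⁻ {v} {z = z} rep passes = refutes-cong (relation-table rep z) (test-sound (tableAt (toℕ z ∷ v)) passes)

    witnessed⁺ : ∀ {v val} → Represents v val → IsRefutation val → T (witnessed v)
    witnessed⁺ {v} {val} rep refutation = T-not⁺ λ some →
      let a , a<n , fails = anyBelow⁻ n some in
      T-not⁻ fails (subst (λ a → T (test (tableAt (a ∷ v)))) (toℕ-fromℕ< a<n)
        (test⁺ {val = val} rep (refutation (fromℕ< a<n))))

    witnessed⁻ : ∀ {v val} → Represents v val → T (witnessed v) → IsRefutation val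
    witnessed⁻ {v} {val} rep witness z with test (tableAt (toℕ z ∷ v)) in eq
    ... | true  = test⁻ rep (subst T (sym eq) _)
    ... | false = contradiction
      (anyBelow⁺ {β = λ a → not (test (tableAt (a ∷ v)))} (toℕ<n z) (subst (T ∘ not) (sym eq) _))
      (T-not⁻ witness)

    -- The loops are steered towards `w`: each variable either awaits its loop or already has its
    -- value in `w`.
    nested⁺ : ∀ is v w → (∀ i → i ∈ˡ is ⊎ lookup v i ≡ lookup w i) → (∀ i → lookup w i < n) →
              T (witnessed w) → T (anyNested is v)
    nested⁺ [] v w agree _ witness =
      subst (T ∘ witnessed) (sym (lookup-injective v w λ i → [ (λ ()) , id ]′ (agree i))) witness
    nested⁺ (i ∷ is) v w agree w<n witness =
      anyBelow⁺ {β = λ a → anyNested is (v [ i ]≔ a)} (w<n i) (nested⁺ is (v [ i ]≔ lookup w i) w agree′ w<n witness)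
      where
      agree′ : ∀ j → j ∈ˡ is ⊎ lookup (v [ i ]≔ lookup w i) j ≡ lookup w j
      agree′ j with j Fin.≟ i | agree j
      ... | yes refl | _                 = inj₂ (Vec.lookup∘update i v _)
      ... | no j≢i   | inj₁ (here refl)  = contradiction refl j≢i
      ... | no _     | inj₁ (there j∈is) = inj₁ j∈is
      ... | no j≢i   | inj₂ eq           = inj₂ (trans (Vec.lookup∘update′ j≢i v _) eq)

    -- Only assigned variables are known to lie below `n`: the initial zeros do not when the
    -- framework is empty.
    nested⁻ : ∀ is v → (∀ i → i ∈ˡ is ⊎ lookup v i < n) → T (anyNested is v) →
              ∃[ w ] (∀ i → lookup w i < n) × T (witnessed w)
    nested⁻ [] v bounded witness = v , (λ i → [ (λ ()) , id ]′ (bounded i)) , witness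
    nested⁻ (i ∷ is) v bounded some =
      let a , a<n , rest = anyBelow⁻ n some in nested⁻ is (v [ i ]≔ a) (bounded′ a a<n) rest
      where
      bounded′ : ∀ a → a < n → ∀ j → j ∈ˡ is ⊎ lookup (v [ i ]≔ a) j < n
      bounded′ a a<n j with j Fin.≟ i | bounded j
      ... | yes refl | _                 = inj₂ (subst (_< n) (sym (Vec.lookup∘update i v a)) a<n)
      ... | no j≢i   | inj₁ (here refl)  = contradiction refl j≢i
      ... | no _     | inj₁ (there j∈is) = inj₁ j∈is
      ... | no j≢i   | inj₂ v<n          = inj₂ (subst (_< n) (sym (Vec.lookup∘update′ j≢i v a)) v<n)

    refuted-by-search : Bool
    refuted-by-search = anyNested (List.allFin (2 + k)) (zeros (2 + k))

    search-reflects : InDegreeBoundedBy F k → Reflects (NaiveBijective F) (not refuted-by-search)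
    search-reflects bounded = reflects-not found⇒ ¬found⇒
      where
      found⇒ : T refuted-by-search → ¬ NaiveBijective F
      found⇒ some =
        let w , w<n , witness = nested⁻ (List.allFin (2 + k)) (zeros (2 + k)) (λ i → inj₁ (∈-allFin i)) some
        in refutation⇒¬bijective F (fromℕ< (w<n zero)) (λ i → fromℕ< (w<n (suc i)))
             (witnessed⁻ {w} {λ i → fromℕ< (w<n i)} (represents λ i → sym (toℕ-fromℕ< (w<n i))) witness)
      ¬found⇒ : ¬ T refuted-by-search → NaiveBijective F
      ¬found⇒ none = ¬refutation⇒bijective F bounded λ x t refutation →
        let val = λ { zero → x ; (suc i) → t i }
            rep = Vec.lookup∘tabulate (toℕ ∘ val)
        in none (nested⁺ (List.allFin (2 + k)) (zeros (2 + k)) (tabulate (toℕ ∘ val)) (λ i → inj₁ (∈-allFin i))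
             (λ i → subst (_< n) (sym (rep i)) (toℕ<n (val i))) (witnessed⁺ {val = val} (represents rep) refutation))

    opaque
      unfolding _!_

      initial-holds : Holds (contents 0 0 blank blank) (layout 0 0 0)
                            (wordTape (encode F) ∷ replicate _ emptyTape)
      initial-holds = holds λ where
          input     → wordTape-shows (encode F)
          found     → shows-cong blank-cell refl emptyTape-shows
          refuted   → shows-cong blank-cell refl emptyTape-shows
          sweep     → shows-cong blank-cells refl emptyTape-shows
          (var i)   → empty-slot (suc (suc (suc (i ↑ˡ (m * m)))))
          (mat i j) → empty-slot (suc (suc (suc (m ↑ʳ combine i j))))
        where
        blank-cell : ∀ q → blank ≡ cell blank q
        blank-cell zero    = refl
        blank-cell (suc _) = refl
        blank-cells : ∀ {f} q → blank ≡ cells 0 f q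
        blank-cells zero    = sym cells-zero
        blank-cells (suc _) = sym (cells-outside z≤n)
        empty-slot : ∀ {f} j → Shows (cells 0 f) 0 (lookup (replicate (3 + (m + m * m)) emptyTape) j)
        empty-slot {f} j = subst (Shows (cells 0 f) 0) (sym (Vec.lookup-replicate j emptyTape))
          (shows-cong blank-cells refl emptyTape-shows)

    halts : ∀ {ts t} → search test ⊢ wordTape (encode F) ∷ replicate _ emptyTape ⇒[ t ] ts →
            initial (encode F) ⇓[ t + 1 ] verdict (heads ts)
    halts = compile-correct (search test) verdict

    decided : HaltsOnWithin machine F (searchTime n + 1) (not refuted-by-search)
    decided =
      let ts , t , t≤ , run , flagged flag H = execute triple-search initial-holds
      in t + 1 , ℕ.+-monoˡ-≤ 1 t≤
       , subst (λ b → initial (encode F) ⇓[ t + 1 ] not b) (trans (cong isOne (holds-heads H found)) flag) (halts run)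

proposition1 : (k : ℕ) → Σ[ M ∈ TuringMachine ] DecidesInPolynomialTime M (λ F → InDegreeBoundedBy F k) NaiveBijective
proposition1 k =
  machine , c , d , λ F bounded →
    let t , t≤ , run = decided F
    in not (refuted-by-search F)
     , (t , ℕ.≤-trans t≤ (time≤ (AF.args F) (size F) (ℕ.m≤m+n (AF.args F) _)) , run)
     , search-reflects F bounded
  where
  open Decision k
  form = poly-closed-form (poly-+ poly-search (poly-const 1))
  c = proj₁ form
  d = proj₁ (proj₂ form)
  time≤ = proj₂ (proj₂ form)
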